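{- Every sequence of roux lines has unit-norm representatives that form an equiangular tight frame for their span.
   Context: Let $\Gamma$ be a finite multiplicative abelian group, identified with its image in the group ring $\mathbb{C}[\Gamma]$. A roux for $\Gamma$ is a matrix $B\in\mathbb{C}[\Gamma]^{n\times n}$ such that: (R1) $B_{ii}=0$ for every $i$; (R2) $B_{ij}\in\Gamma$ for $i\ne j$; (R3) $B_{ji}=(B_{ij})^{ -1}$ for $i\neq j$; (R4) the matrices $\{gI\}_{g\in\Gamma}$ and $\{gB\}_{g\in\Gamma}$ span an algebra. For a character $\alpha\in\hat\Gamma$ (a homomorphism from $\Gamma$ to the complex unit circle), $\hat\alpha(B)\in\mathbb{C}^{n\times n}$ denotes the result of extending $\alpha$ linearly to $\mathbb{C}[\Gamma]$ and applying it to each entry of $B$ ("evaluating $B$ at $\alpha$"). Lines are one-dimensional complex subspaces. A sequence of $n$ lines is linearly dependent if their span has dimension $d<n$. A signature matrix is a self-adjoint matrix with zero diagonal and unit-modulus off-diagonal entries. Unit vectors $\{\varphi_i\}_{i\in[n]}$ have signature matrix $\mathcal S$ if their Gram matrix $(\langle\varphi_j,\varphi_i\rangle)_{ij}$ equals $I+\mu\mathcal S$ with $\mu>0$. Roux lines are any sequence of linearly dependent lines for which there exist unit-norm representatives whose signature matrix is $\hat\alpha(B)$ for some roux $B$ for some finite abelian group $\Gamma$ and some $\alpha\in\hat\Gamma$. Unit vectors $\{\varphi_i\}_{i\in[n]}$ form an equiangular tight frame for their span if $|\langle\varphi_i,\varphi_j\rangle|^2$ is the same for all $i\ne j$ and $\sum_i\varphi_i\varphi_i^*$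 is a scalar multiple of the orthogonal projection onto their span. -}

module Defs where

open import Algebra.Bundles using (AbelianGroup)
open import Algebra.Bundles.Raw using (RawRing)
import Algebra.Definitions.RawMonoid as RawMonoidDefinitions
open import Algebra.Module.Bundles.Raw using (RawLeftModule)
open import Algebra.Morphism.Structures using (IsMonoidHomomorphism)
open import Data.Bool.Base using (if_then_else_)
open import Data.Fin.Base using (Fin)
import Data.Fin.Properties as Fin
open import Data.Nat.Base as ℕ using (ℕ)
import Data.Nat.Properties as ℕ
open import Data.Product.Base using (∃; _×_; _,_)
open import Data.Rational.Base as ℚ using (ℚ; 0ℚ; 1ℚ; ½)
import Data.Rational.Properties as ℚ
open import Data.Rational.Solver using (module +-*-Solver)
open import Data.Vec.Functional using (Vector; _++_)
open import Function.Bundles using (Inverse; _⇔_)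
open import Level using (0ℓ; _⊔_; suc)
open import Relation.Binary.PropositionalEquality
  using (_≡_; _≢_; refl; sym; trans; cong; subst; setoid)
open import Relation.Nullary.Decidable using (⌊_⌋; toWitness)
open import Relation.Unary using (Pred; _⊆_)

------------------------------------------------------------------------
-- Real numbers: Cauchy sequences of rationals, up to the equivalence of
-- having difference tending to zero.

IsCauchy : (ℕ → ℚ) → Set
IsCauchy x = ∀ ε → 0ℚ ℚ.< ε →
  ∃ λ N → ∀ {m n} → N ℕ.≤ m → N ℕ.≤ n → ℚ.∣ x m ℚ.- x n ∣ ℚ.< ε

-- Without η, and with the operations given by copatterns, terms such as
-- x +ᴿ y below do not unfold until a component is taken.
record ℝ : Set where
  no-eta-equality
  constructor mkℝ
  field
    seq    : ℕ → ℚ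
    cauchy : IsCauchy seq
open ℝ public

infix 4 _≃ᴿ_ _<ᴿ_

record _≃ᴿ_ (x y : ℝ) : Set where
  constructor mk≃
  field
    close : ∀ ε → 0ℚ ℚ.< ε →
            ∃ λ N → ∀ {n} → N ℕ.≤ n → ℚ.∣ seq x n ℚ.- seq y n ∣ ℚ.< ε
open _≃ᴿ_ public

-- A fixed rational gap is needed: eventual termwise _<_ does not imply
-- that the limits differ.
record _<ᴿ_ (x y : ℝ) : Set where
  constructor mk<
  field
    gap      : ℚ
    gap-pos  : 0ℚ ℚ.< gap
    from     : ℕ
    separate : ∀ {n} → from ℕ.≤ n → seq x n ℚ.+ gap ℚ.≤ seq y n

private
  0<½ : 0ℚ ℚ.< ½
  0<½ = toWitness {a? = 0ℚ ℚ.<? ½} _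

  *-pos : ∀ {p q} → 0ℚ ℚ.< p → 0ℚ ℚ.< q → 0ℚ ℚ.< p ℚ.* q
  *-pos {p} {q} 0<p 0<q =
    subst (ℚ._< p ℚ.* q) (ℚ.*-zeroʳ p) (ℚ.*-monoʳ-<-pos p {{ℚ.positive 0<p}} 0<q)

  halves : ∀ ε → ½ ℚ.* ε ℚ.+ ½ ℚ.* ε ≡ ε
  halves ε = trans (sym (ℚ.*-distribʳ-+ ε ½ ½)) (ℚ.*-identityˡ ε)

  ∣+∣-< : ∀ p q {δ} → ℚ.∣ p ∣ ℚ.< ½ ℚ.* δ → ℚ.∣ q ∣ ℚ.< ½ ℚ.* δ → ℚ.∣ p ℚ.+ q ∣ ℚ.< δ
  ∣+∣-< p q {δ} hp hq = ℚ.≤-<-trans (ℚ.∣p+q∣≤∣p∣+∣q∣ p q)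
    (subst (ℚ.∣ p ∣ ℚ.+ ℚ.∣ q ∣ ℚ.<_) (halves δ) (ℚ.+-mono-< hp hq))

  ≤-⊔ˡ : ∀ {M N n} → M ℕ.⊔ N ℕ.≤ n → M ℕ.≤ n
  ≤-⊔ˡ {M} {N} = ℕ.≤-trans (ℕ.m≤m⊔n M N)

  ≤-⊔ʳ : ∀ {M N n} → M ℕ.⊔ N ℕ.≤ n → N ℕ.≤ n
  ≤-⊔ʳ {M} {N} = ℕ.≤-trans (ℕ.m≤n⊔m M N)

  const-cauchy : ∀ q → IsCauchy (λ _ → q)
  const-cauchy q ε 0<ε =
    0 , λ _ _ → subst (ℚ._< ε) (sym (cong ℚ.∣_∣ (ℚ.+-inverseʳ q))) 0<ε

  +-cauchy : ∀ {x y} → IsCauchy x → IsCauchy y → IsCauchy (λ n → x n ℚ.+ y n)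
  +-cauchy {x} {y} cx cy ε 0<ε
    with cx (½ ℚ.* ε) (*-pos 0<½ 0<ε) | cy (½ ℚ.* ε) (*-pos 0<½ 0<ε)
  ... | M , hM | N , hN = M ℕ.⊔ N , λ {m} {n} m≥ n≥ →
    subst (λ z → ℚ.∣ z ∣ ℚ.< ε) (rearrange (x m) (x n) (y m) (y n))
      (∣+∣-< (x m ℚ.- x n) (y m ℚ.- y n)
        (hM (≤-⊔ˡ m≥) (≤-⊔ˡ n≥)) (hN (≤-⊔ʳ {M} m≥) (≤-⊔ʳ {M} n≥)))
    where
    open +-*-Solver
    rearrange : ∀ a b c d → (a ℚ.- b) ℚ.+ (c ℚ.- d) ≡ (a ℚ.+ c) ℚ.- (b ℚ.+ d)
    rearrange = solve 4 (λ a b c d → (a :- b) :+ (c :- d) := (a :+ c) :- (b :+ d)) refl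

  neg-cauchy : ∀ {x} → IsCauchy x → IsCauchy (λ n → ℚ.- x n)
  neg-cauchy {x} cx ε 0<ε with cx ε 0<ε
  ... | N , hN = N , λ {m} {n} m≥ n≥ →
    subst (λ z → ℚ.∣ z ∣ ℚ.< ε) (rearrange (x n) (x m)) (hN n≥ m≥)
    where
    open +-*-Solver
    rearrange : ∀ a b → a ℚ.- b ≡ (ℚ.- b) ℚ.- (ℚ.- a)
    rearrange = solve 2 (λ a b → a :- b := (:- b) :- (:- a)) refl

  EventuallyBounded : (ℕ → ℚ) → Set
  EventuallyBounded x = ∃ λ K → 0ℚ ℚ.< K × ∃ λ N → ∀ {n} → N ℕ.≤ n → ℚ.∣ x n ∣ ℚ.≤ K

  cauchy⇒bounded : ∀ {x} → IsCauchy x → EventuallyBounded x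
  cauchy⇒bounded {x} cx with cx 1ℚ (toWitness {a? = 0ℚ ℚ.<? 1ℚ} _)
  ... | N , hN =
    ℚ.∣ x N ∣ ℚ.+ 1ℚ ,
    ℚ.+-mono-≤-< (ℚ.0≤∣p∣ (x N)) (toWitness {a? = 0ℚ ℚ.<? 1ℚ} _) ,
    N , λ {n} n≥ →
      subst (λ z → ℚ.∣ z ∣ ℚ.≤ ℚ.∣ x N ∣ ℚ.+ 1ℚ) (rearrange (x N) (x n))
        (ℚ.≤-trans (ℚ.∣p+q∣≤∣p∣+∣q∣ (x N) (x n ℚ.- x N))
          (ℚ.+-monoʳ-≤ ℚ.∣ x N ∣ (ℚ.<⇒≤ (hN n≥ ℕ.≤-refl))))
    where
    open +-*-Solver
    rearrange : ∀ a b → a ℚ.+ (b ℚ.- a) ≡ b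
    rearrange = solve 2 (λ a b → a :+ (b :- a) := b) refl

  pos-inverse : ∀ q → 0ℚ ℚ.< q → ∃ λ r → 0ℚ ℚ.< r × q ℚ.* r ≡ 1ℚ
  pos-inverse q 0<q = r , ℚ.positive⁻¹ r {{ℚ.1/pos⇒pos q {{ℚ.positive 0<q}}}} ,
                      ℚ.*-inverseʳ q {{q≢0}}
    where
    q≢0 : ℚ.NonZero q
    q≢0 = ℚ.pos⇒nonZero q {{ℚ.positive 0<q}}
    r : ℚ
    r = (ℚ.1/ q) {{q≢0}}

  ∣*∣-< : ∀ {q r δ} → 0ℚ ℚ.< q → q ℚ.* r ≡ 1ℚ → ∀ a b →
          ℚ.∣ a ∣ ℚ.≤ q → ℚ.∣ b ∣ ℚ.< r ℚ.* δ → ℚ.∣ a ℚ.* b ∣ ℚ.< δ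
  ∣*∣-< {q} {r} {δ} 0<q qr≡1 a b a≤ b< =
    subst (ℚ._< δ) (sym (ℚ.∣p*q∣≡∣p∣*∣q∣ a b))
      (ℚ.≤-<-trans
        (ℚ.*-monoʳ-≤-nonNeg ℚ.∣ b ∣ {{ℚ.nonNegative (ℚ.0≤∣p∣ b)}} a≤)
        (subst (q ℚ.* ℚ.∣ b ∣ ℚ.<_) cancel
          (ℚ.*-monoʳ-<-pos q {{ℚ.positive 0<q}} b<)))
    where
    cancel : q ℚ.* (r ℚ.* δ) ≡ δ
    cancel = trans (sym (ℚ.*-assoc q r δ))
      (trans (cong (ℚ._* δ) qr≡1) (ℚ.*-identityˡ δ))

  *-cauchy : ∀ {x y} → IsCauchy x → IsCauchy y → IsCauchy (λ n → x n ℚ.* y n)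
  *-cauchy {x} {y} cx cy ε 0<ε =
    let (K , 0<K , A , hA) = cauchy⇒bounded cx
        (L , 0<L , B , hB) = cauchy⇒bounded cy
        (r , 0<r , Kr≡1)   = pos-inverse K 0<K
        (s , 0<s , Ls≡1)   = pos-inverse L 0<L
        0<½ε               = *-pos 0<½ 0<ε
        (M , hM)           = cx (s ℚ.* (½ ℚ.* ε)) (*-pos 0<s 0<½ε)
        (N , hN)           = cy (r ℚ.* (½ ℚ.* ε)) (*-pos 0<r 0<½ε)
    in (A ℕ.⊔ B) ℕ.⊔ (M ℕ.⊔ N) , λ {m} {n} m≥ n≥ →
      subst (λ z → ℚ.∣ z ∣ ℚ.< ε) (rearrange (x m) (x n) (y m) (y n))
        (∣+∣-< (x m ℚ.* (y m ℚ.- y n)) (y n ℚ.* (x m ℚ.- x n))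
          (∣*∣-< 0<K Kr≡1 (x m) (y m ℚ.- y n)
            (hA (≤-⊔ˡ (≤-⊔ˡ m≥)))
            (hN (≤-⊔ʳ {M} (≤-⊔ʳ {A ℕ.⊔ B} m≥)) (≤-⊔ʳ {M} (≤-⊔ʳ {A ℕ.⊔ B} n≥))))
          (∣*∣-< 0<L Ls≡1 (y n) (x m ℚ.- x n)
            (hB (≤-⊔ʳ {A} (≤-⊔ˡ n≥)))
            (hM (≤-⊔ˡ (≤-⊔ʳ {A ℕ.⊔ B} m≥)) (≤-⊔ˡ (≤-⊔ʳ {A ℕ.⊔ B} n≥)))))
    where
    open +-*-Solver
    rearrange : ∀ a b c d → a ℚ.* (c ℚ.- d) ℚ.+ d ℚ.* (a ℚ.- b) ≡ a ℚ.* c ℚ.- b ℚ.* d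
    rearrange = solve 4
      (λ a b c d → a :* (c :- d) :+ d :* (a :- b) := a :* c :- b :* d) refl

infixl 7 _*ᴿ_
infixl 6 _+ᴿ_
infix  8 -ᴿ_

0ᴿ 1ᴿ : ℝ
seq    0ᴿ _ = 0ℚ
cauchy 0ᴿ   = const-cauchy 0ℚ
seq    1ᴿ _ = 1ℚ
cauchy 1ᴿ   = const-cauchy 1ℚ

_+ᴿ_ _*ᴿ_ : ℝ → ℝ → ℝ
seq    (x +ᴿ y) n = seq x n ℚ.+ seq y n
cauchy (x +ᴿ y)   = +-cauchy {seq x} {seq y} (cauchy x) (cauchy y)
seq    (x *ᴿ y) n = seq x n ℚ.* seq y n
cauchy (x *ᴿ y)   = *-cauchy {seq x} {seq y} (cauchy x) (cauchy y)

-ᴿ_ : ℝ → ℝ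
seq    (-ᴿ x) n = ℚ.- seq x n
cauchy (-ᴿ x)   = neg-cauchy {seq x} (cauchy x)

------------------------------------------------------------------------
-- Complex numbers

record ℂ : Set where
  no-eta-equality
  constructor _+i_
  field
    re im : ℝ
open ℂ public

infix  4 _≃ᶜ_
infix  5 _+i_
infixl 6 _+ᶜ_
infixl 7 _*ᶜ_
infix  8 -ᶜ_

record _≃ᶜ_ (z w : ℂ) : Set where
  constructor mk≃ᶜ
  field
    re≃ : re z ≃ᴿ re w
    im≃ : im z ≃ᴿ im w
open _≃ᶜ_ public

fromℝ : ℝ → ℂ
re (fromℝ x) = x
im (fromℝ x) = 0ᴿ

_+ᶜ_ _*ᶜ_ : ℂ → ℂ → ℂ
re (z +ᶜ w) = re z +ᴿ re w
im (z +ᶜ w) = im z +ᴿ im w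
re (z *ᶜ w) = re z *ᴿ re w +ᴿ -ᴿ (im z *ᴿ im w)
im (z *ᶜ w) = re z *ᴿ im w +ᴿ im z *ᴿ re w

-ᶜ_ : ℂ → ℂ
re (-ᶜ z) = -ᴿ re z
im (-ᶜ z) = -ᴿ im z

conj : ℂ → ℂ
re (conj z) = re z
im (conj z) = -ᴿ im z

ℂ-rawRing : RawRing 0ℓ 0ℓ
ℂ-rawRing = record
  { Carrier = ℂ
  ; _≈_     = _≃ᶜ_
  ; _+_     = _+ᶜ_
  ; _*_     = _*ᶜ_
  ; -_      = -ᶜ_
  ; 0#      = fromℝ 0ᴿ
  ; 1#      = fromℝ 1ᴿ
  }

private module C = RawRing ℂ-rawRing

∣_∣² : ℂ → ℝ
∣ z ∣² = re z *ᴿ re z +ᴿ im z *ᴿ im z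

-- ∣ z ∣ = 1 is expressed as ∣ z ∣² = 1.
UnitModulus : ℂ → Set
UnitModulus z = ∣ z ∣² ≃ᴿ 1ᴿ

sumᶜ : ∀ {n} → Vector ℂ n → ℂ
sumᶜ = RawMonoidDefinitions.sum C.+-rawMonoid

------------------------------------------------------------------------
-- Linear algebra over ℂ

ℂ-Module : Set₁
ℂ-Module = RawLeftModule ℂ 0ℓ 0ℓ

ℂ¹ : ℂ-Module
ℂ¹ = record
  { Carrierᴹ = ℂ
  ; _≈ᴹ_     = C._≈_
  ; _+ᴹ_     = C._+_
  ; _*ₗ_     = C._*_
  ; 0ᴹ       = C.0#
  ; -ᴹ_      = C.-_
  }

infixl 9 _^ᴹ_

_^ᴹ_ : ℂ-Module → ℕ → ℂ-Module
M ^ᴹ n = record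
  { Carrierᴹ = Vector M.Carrierᴹ n
  ; _≈ᴹ_     = λ u v → ∀ i → u i M.≈ᴹ v i
  ; _+ᴹ_     = λ u v i → u i M.+ᴹ v i
  ; _*ₗ_     = λ c v i → c M.*ₗ v i
  ; 0ᴹ       = λ _ → M.0ᴹ
  ; -ᴹ_      = λ v i → M.-ᴹ (v i)
  }
  where module M = RawLeftModule M

module LinearAlgebra (M : ℂ-Module) where
  open RawLeftModule M

  sumᴹ : ∀ {n} → Vector Carrierᴹ n → Carrierᴹ
  sumᴹ = RawMonoidDefinitions.sum +ᴹ-rawMonoid

  linearCombination : ∀ {n} → Vector ℂ n → Vector Carrierᴹ n → Carrierᴹ
  linearCombination c f = sumᴹ (λ i → c i *ₗ f i)

  Span : ∀ {n} → Vector Carrierᴹ n → Pred Carrierᴹ 0ℓ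
  Span f v = ∃ λ c → v ≈ᴹ linearCombination c f

  LinearlyIndependent : ∀ {n} → Vector Carrierᴹ n → Set
  LinearlyIndependent f = ∀ c → linearCombination c f ≈ᴹ 0ᴹ → ∀ i → c i C.≈ C.0#

  record IsSubspace {p} (V : Pred Carrierᴹ p) : Set p where
    field
      resp      : ∀ {u v} → u ≈ᴹ v → V u → V v
      0-closed  : V 0ᴹ
      +-closed  : ∀ {u v} → V u → V v → V (u +ᴹ v)
      *ₗ-closed : ∀ c {v} → V v → V (c *ₗ v)

  record HasDimension {p} (V : Pred Carrierᴹ p) (d : ℕ) : Set p where
    field
      basis       : Vector Carrierᴹ d
      basis∈V     : ∀ k → V (basis k)
      independent : LinearlyIndependent basis
      spanning    : V ⊆ Span basis

  -- The span of the union of a finite sequence of subspaces.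
  SpanOf : ∀ {p n} → (Fin n → Pred Carrierᴹ p) → Pred Carrierᴹ p
  SpanOf V v = ∃ λ w → (∀ i → V i (w i)) × v ≈ᴹ sumᴹ w

Matrix : ∀ {a} → Set a → ℕ → ℕ → Set a
Matrix A m n = Vector (Vector A n) m

module MatrixOperations {a ℓ} (R : RawRing a ℓ) where
  open RawRing R

  infix 4 _≋_

  _≋_ : ∀ {m n} → Matrix Carrier m n → Matrix Carrier m n → Set ℓ
  A ≋ B = ∀ i j → A i j ≈ B i j

  identity : ∀ n → Matrix Carrier n n
  identity n i j = if ⌊ i Fin.≟ j ⌋ then 1# else 0#

  infixl 6 _⊕_
  infixl 7 _⊗_ _·_

  _⊕_ : ∀ {m n} → Matrix Carrier m n → Matrix Carrier m n → Matrix Carrier m n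
  (A ⊕ B) i j = A i j + B i j

  _⊗_ : ∀ {l m n} → Matrix Carrier l m → Matrix Carrier m n → Matrix Carrier l n
  (A ⊗ B) i k = RawMonoidDefinitions.sum +-rawMonoid (λ j → A i j * B j k)

  _·_ : ∀ {m n} → Carrier → Matrix Carrier m n → Matrix Carrier m n
  (r · A) i j = r * A i j

open MatrixOperations ℂ-rawRing public

_ᴴ : ∀ {m n} → Matrix ℂ m n → Matrix ℂ n m
(A ᴴ) i j = conj (A j i)

ℂ^_ : ℕ → ℂ-Module
ℂ^ d = ℂ¹ ^ᴹ d

ℂVec : ℕ → Set
ℂVec d = RawLeftModule.Carrierᴹ (ℂ^ d)

-- Linear in the first argument, so that (⟨ φ j , φ i ⟩)ᵢⱼ = Φᴴ Φ when Φ
-- has columns φ.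
⟨_,_⟩ : ∀ {d} → ℂVec d → ℂVec d → ℂ
⟨ u , v ⟩ = sumᶜ (λ k → u k C.* conj (v k))

apply : ∀ {m n} → Matrix ℂ m n → ℂVec n → ℂVec m
apply A v i = sumᶜ (λ j → A i j C.* v j)

record IsOrthogonalProjectionOnto {d p} (P : Matrix ℂ d d) (W : Pred (ℂVec d) p) : Set p where
  open RawLeftModule (ℂ^ d) using (_≈ᴹ_)
  field
    idempotent  : P ⊗ P ≋ P
    selfAdjoint : P ᴴ ≋ P
    range       : ∀ v → W v ⇔ (∃ λ u → v ≈ᴹ apply P u)

------------------------------------------------------------------------
-- Group rings, roux and characters

record FiniteAbelianGroup c ℓ : Set (suc (c ⊔ ℓ)) where
  field
    abelianGroup : AbelianGroup c ℓ
    order        : ℕ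
    enumeration  : Inverse (setoid (Fin order)) (AbelianGroup.setoid abelianGroup)

  open AbelianGroup abelianGroup public
  open Inverse enumeration public using () renaming (to to element; from to index)

module _ {c ℓ} (Γ : FiniteAbelianGroup c ℓ) where
  open FiniteAbelianGroup Γ

  -- x k is the coefficient of the group element with index k.
  groupModule : ℂ-Module
  groupModule = ℂ^ order

  private
    module GM = RawLeftModule groupModule

  embed : Carrier → Vector ℂ order
  embed g k = if ⌊ k Fin.≟ index g ⌋ then C.1# else C.0#

  -- Multiplication is convolution: (x y)(h) = Σ_g x(g) y(g⁻¹ h).
  groupRing : RawRing 0ℓ 0ℓ
  groupRing = record
    { Carrier = GM.Carrierᴹ
    ; _≈_     = GM._≈ᴹ_
    ; _+_     = GM._+ᴹ_
    ; _*_     = λ x y k → sumᶜ (λ i → x i C.* y (index (element i ⁻¹ ∙ element k)))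
    ; -_      = GM.-ᴹ_
    ; 0#      = GM.0ᴹ
    ; 1#      = embed ε
    }

  private
    module GR = RawRing groupRing
    module Mat = MatrixOperations groupRing

  record IsAlgebra {n p} (𝒜 : Pred (Matrix GR.Carrier n n) p) : Set p where
    field
      isSubspace : LinearAlgebra.IsSubspace (groupModule ^ᴹ n ^ᴹ n) 𝒜
      ⊗-closed   : ∀ {X Y} → 𝒜 X → 𝒜 Y → 𝒜 (X Mat.⊗ Y)

  record IsRoux {n} (B : Matrix GR.Carrier n n) : Set c where
    field
      diagonal : ∀ i → B i i GR.≈ GR.0#
      entries  : ∀ {i j} → i ≢ j → ∃ λ g → B i j GR.≈ embed g
      inverse  : ∀ {i j} → i ≢ j → ∀ g → B i j GR.≈ embed g → B j i GR.≈ embed (g ⁻¹)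
      algebra  : IsAlgebra (LinearAlgebra.Span (groupModule ^ᴹ n ^ᴹ n)
        ((λ k → embed (element k) Mat.· Mat.identity n) ++
         (λ k → embed (element k) Mat.· B)))

  record Character : Set (c ⊔ ℓ) where
    field
      ⟦_⟧                  : Carrier → ℂ
      isMonoidHomomorphism : IsMonoidHomomorphism rawMonoid C.*-rawMonoid ⟦_⟧
      unitModulus          : ∀ g → UnitModulus ⟦ g ⟧

  extend : Character → GR.Carrier → ℂ
  extend α x = sumᶜ (λ k → x k C.* Character.⟦_⟧ α (element k))

  evaluate : ∀ {n} → Character → Matrix GR.Carrier n n → Matrix ℂ n n
  evaluate α B i j = extend α (B i j)

------------------------------------------------------------------------
-- Lines and frames

record Line (D : ℕ) p : Set (suc p) where
  field
    _∋_          : Pred (ℂVec D) p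
    isSubspace   : LinearAlgebra.IsSubspace (ℂ^ D) _∋_
    dimensionOne : LinearAlgebra.HasDimension (ℂ^ D) _∋_ 1
open Line public using (_∋_)

LinearlyDependentLines : ∀ {D n p} → (Fin n → Line D p) → Set p
LinearlyDependentLines {D} {n} L =
  ∃ λ d → d ℕ.< n × HasDimension (SpanOf (λ i → L i ∋_)) d
  where open LinearAlgebra (ℂ^ D)

UnitNorm : ∀ {D n} → Vector (ℂVec D) n → Set
UnitNorm φ = ∀ i → ⟨ φ i , φ i ⟩ C.≈ C.1#

Represents : ∀ {D n p} → Vector (ℂVec D) n → (Fin n → Line D p) → Set p
Represents φ L = UnitNorm φ × (∀ i → L i ∋ φ i)

record IsSignatureMatrix {n} (S : Matrix ℂ n n) : Set where
  field
    selfAdjoint  : S ᴴ ≋ S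
    zeroDiagonal : ∀ i → S i i C.≈ C.0#
    unitModulus  : ∀ {i j} → i ≢ j → UnitModulus (S i j)

gram : ∀ {D n} → Vector (ℂVec D) n → Matrix ℂ n n
gram φ i j = ⟨ φ j , φ i ⟩

record HasSignatureMatrix {D n} (φ : Vector (ℂVec D) n) (S : Matrix ℂ n n) : Set where
  field
    isSignatureMatrix : IsSignatureMatrix S
    μ                 : ℝ
    μ-positive        : 0ᴿ <ᴿ μ
    gram≋             : gram φ ≋ identity n ⊕ fromℝ μ · S

record IsRouxLines c ℓ {D n p} (L : Fin n → Line D p) : Set (suc (c ⊔ ℓ) ⊔ p) where
  field
    linearlyDependent : LinearlyDependentLines L
    representatives   : Vector (ℂVec D) n
    represents        : Represents representatives L
    Γ                 : FiniteAbelianGroup c ℓ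
    roux              : Matrix (RawRing.Carrier (groupRing Γ)) n n
    isRoux            : IsRoux Γ roux
    α                 : Character Γ
    hasSignature      : HasSignatureMatrix representatives (evaluate Γ α roux)

-- Σᵢ φᵢ φᵢᴴ
frameOperator : ∀ {D n} → Vector (ℂVec D) n → Matrix ℂ D D
frameOperator {D} φ =
  LinearAlgebra.sumᴹ (ℂ^ D ^ᴹ D) (λ i k l → φ i k C.* conj (φ i l))

record IsEquiangularTightFrameForSpan {D n} (φ : Vector (ℂVec D) n) : Set where
  field
    unitNorm    : UnitNorm φ
    equiangular : ∀ {i j k l} → i ≢ j → k ≢ l →
                  ∣ ⟨ φ i , φ j ⟩ ∣² ≃ᴿ ∣ ⟨ φ k , φ l ⟩ ∣²
    tight       : ∃ λ c → ∃ λ P →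
                  IsOrthogonalProjectionOnto P (LinearAlgebra.Span (ℂ^ D) φ) ×
                  frameOperator φ ≋ c · P

{-# OPTIONS --safe #-}
-- The algebra of the roux contains B², so evaluating at α gives S² = a I + b S for the
-- signature matrix S, and the Gram matrix G = I + μ S satisfies G² + p I = p G + t I
-- with p = 2 + μ b and t = 1 + μ² a.  Linear dependence gives a nonzero vector in the
-- kernel of G, which forces p = t and hence G² = p G.  Comparing diagonal entries, p is
-- the squared norm of a column of G; this is real and positive since Gᵢᵢ = 1.  Writing
-- Φ for the matrix with columns φᵢ, so that G = Φᴴ Φ, the matrix Y = G - p I satisfies
-- Φᴴ Φ Y = 0, thus Φ Y = 0, and Φ Φᴴ / p is the orthogonal projection onto the span.
--
-- Kernel vectors are found only up to double negation, as the elimination needs to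
-- decide whether a complex number vanishes; equality of complex numbers is stable, so
-- this suffices for p = t.
module Submission where

open import Algebra.Bundles using (CommutativeRing)
open import Algebra.Bundles.Raw using (RawRing)
open import Algebra.Definitions.RawMonoid using () renaming (sum to rawSum)
open import Algebra.Module.Bundles.Raw using (RawLeftModule)
open import Algebra.Morphism.Structures using (IsMonoidHomomorphism)
import Algebra.Properties.Group as GroupProperties
import Algebra.Properties.Monoid.Sum as MonoidSum
import Algebra.Properties.Ring as RingProperties
import Algebra.Properties.Semiring.Sum as SemiringSum
import Algebra.Solver.Ring.NaturalCoefficients.Default as SemiringSolver
open import Data.Fin.Base using (Fin; zero; suc; punchIn; _↑ʳ_)
open import Data.Fin.Permutation using (Permutation′; permutation)
import Data.Fin.Properties as Fin
open import Data.Nat.Base as ℕ using (ℕ; zero; suc; s≤s)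
import Data.Nat.Properties as ℕ
open import Data.Product.Base using (∃; _×_; _,_; proj₁; proj₂)
open import Data.Rational.Base as ℚ using (ℚ; 0ℚ; 1ℚ; ½; ∣_∣)
import Data.Rational.Properties as ℚ
open import Data.Rational.Solver using (module +-*-Solver)
open import Data.Sum.Base using (inj₁; inj₂)
open import Data.Vec.Functional using (Vector; _++_; insertAt; removeAt)
open import Data.Vec.Functional.Properties using (insertAt-lookup; insertAt-punchIn; lookup-++ʳ)
import Data.Vec.Functional.Relation.Unary.All.Properties as All
open import Function.Base using (_∘_)
open import Function.Bundles using (Inverse; mk⇔)
open import Level using (Level; 0ℓ)
open import Relation.Binary.Bundles using (Setoid)
import Relation.Binary.PropositionalEquality as ≡
open ≡ using (_≡_; _≢_)
import Relation.Binary.Reasoning.Setoid as SetoidReasoning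
open import Relation.Nullary.Decidable using (toWitness; yes; no; ¬¬-excluded-middle)
open import Relation.Nullary.Negation using (¬_; contradiction)
open import Relation.Unary using (Pred)
open import Defs hiding (_≋_; identity; _⊕_; _⊗_; _·_)

-- Real numbers

module Reals where
  open ≡ using (refl; sym; trans; cong; cong₂; subst; subst₂)

  -- Inequalities between rationals.

  private
    variable
      x y z w : ℝ
      f g : ℕ → ℚ
      p q r δ ε : ℚ

    *-pos : 0ℚ ℚ.< p → 0ℚ ℚ.< q → 0ℚ ℚ.< p ℚ.* q
    *-pos {p} {q} 0<p 0<q =
      subst (ℚ._< p ℚ.* q) (ℚ.*-zeroʳ p) (ℚ.*-monoʳ-<-pos p {{ℚ.positive 0<p}} 0<q)

    0<½ : 0ℚ ℚ.< ½
    0<½ = toWitness {a? = 0ℚ ℚ.<? ½} _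

    0<1 : 0ℚ ℚ.< 1ℚ
    0<1 = toWitness {a? = 0ℚ ℚ.<? 1ℚ} _

    half-pos : 0ℚ ℚ.< ε → 0ℚ ℚ.< ½ ℚ.* ε
    half-pos = *-pos 0<½

    half+half : ∀ ε → ½ ℚ.* ε ℚ.+ ½ ℚ.* ε ≡ ε
    half+half ε = trans (sym (ℚ.*-distribʳ-+ ε ½ ½)) (ℚ.*-identityˡ ε)

    ∣p-q∣≡∣q-p∣ : ∀ p q → ∣ p ℚ.- q ∣ ≡ ∣ q ℚ.- p ∣
    ∣p-q∣≡∣q-p∣ p q = trans (sym (ℚ.∣-p∣≡∣p∣ (p ℚ.- q))) (cong ∣_∣ (lemma p q))
      where
      open +-*-Solver
      lemma : ∀ p q → ℚ.- (p ℚ.- q) ≡ q ℚ.- p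
      lemma = solve 2 (λ p q → :- (p :- q) := q :- p) refl

    ∣+∣-< : ∀ p q → ∣ p ∣ ℚ.< ½ ℚ.* ε → ∣ q ∣ ℚ.< ½ ℚ.* ε → ∣ p ℚ.+ q ∣ ℚ.< ε
    ∣+∣-< {ε} p q hp hq = ℚ.≤-<-trans (ℚ.∣p+q∣≤∣p∣+∣q∣ p q)
      (subst (∣ p ∣ ℚ.+ ∣ q ∣ ℚ.<_) (half+half ε) (ℚ.+-mono-< hp hq))

    <⇒≱ : p ℚ.< q → ¬ q ℚ.≤ p
    <⇒≱ p<q q≤p = ℚ.<-irrefl refl (ℚ.<-≤-trans p<q q≤p)

    *-mono-≤ : 0ℚ ℚ.≤ p → p ℚ.≤ q → 0ℚ ℚ.≤ r → r ℚ.≤ δ → p ℚ.* r ℚ.≤ q ℚ.* δ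
    *-mono-≤ {p} {q} {r} {δ} 0≤p p≤q 0≤r r≤δ = ℚ.≤-trans
      (ℚ.*-monoʳ-≤-nonNeg r {{ℚ.nonNegative 0≤r}} p≤q)
      (ℚ.*-monoˡ-≤-nonNeg q {{ℚ.nonNegative (ℚ.≤-trans 0≤p p≤q)}} r≤δ)

    ∣∣-mono-≤ : 0ℚ ℚ.≤ p → p ℚ.≤ q → ∣ p ∣ ℚ.≤ ∣ q ∣
    ∣∣-mono-≤ 0≤p p≤q =
      subst₂ ℚ._≤_ (sym (ℚ.0≤p⇒∣p∣≡p 0≤p)) (sym (ℚ.0≤p⇒∣p∣≡p (ℚ.≤-trans 0≤p p≤q))) p≤q

    pos-inverse : 0ℚ ℚ.< q → ∃ λ r → 0ℚ ℚ.< r × q ℚ.* r ≡ 1ℚ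
    pos-inverse {q} 0<q =
      ℚ.1/ q , ℚ.positive⁻¹ (ℚ.1/ q) {{ℚ.1/pos⇒pos q}} , ℚ.*-inverseʳ q
      where instance
      pos = ℚ.positive 0<q
      nz  = ℚ.pos⇒nonZero q

    ∣*∣-< : 0ℚ ℚ.< q → q ℚ.* r ≡ 1ℚ → ∀ a b →
            ∣ a ∣ ℚ.≤ q → ∣ b ∣ ℚ.< r ℚ.* δ → ∣ a ℚ.* b ∣ ℚ.< δ
    ∣*∣-< {q} {r} {δ} 0<q qr≡1 a b a≤ b< =
      subst (ℚ._< δ) (sym (ℚ.∣p*q∣≡∣p∣*∣q∣ a b))
        (ℚ.≤-<-trans
          (ℚ.*-monoʳ-≤-nonNeg ∣ b ∣ {{ℚ.nonNegative (ℚ.0≤∣p∣ b)}} a≤)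
          (subst (q ℚ.* ∣ b ∣ ℚ.<_) cancel (ℚ.*-monoʳ-<-pos q {{ℚ.positive 0<q}} b<)))
      where
      cancel : q ℚ.* (r ℚ.* δ) ≡ δ
      cancel = trans (sym (ℚ.*-assoc q r δ)) (trans (cong (ℚ._* δ) qr≡1) (ℚ.*-identityˡ δ))

    ≤-⊔ˡ : ∀ {M N n} → M ℕ.⊔ N ℕ.≤ n → M ℕ.≤ n
    ≤-⊔ˡ {M} {N} = ℕ.≤-trans (ℕ.m≤m⊔n M N)

    ≤-⊔ʳ : ∀ M {N n} → M ℕ.⊔ N ℕ.≤ n → N ℕ.≤ n
    ≤-⊔ʳ M {N} = ℕ.≤-trans (ℕ.m≤n⊔m M N)

  -- Since `∣ q ∣` is `q` or its negative, `q * q` equals `∣ q ∣ * ∣ q ∣`, a product of nonnegative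
  -- numbers.
  square-nonneg : ∀ q → 0ℚ ℚ.≤ q ℚ.* q
  square-nonneg q = subst (0ℚ ℚ.≤_) (trans (sym (ℚ.∣p*q∣≡∣p∣*∣q∣ q q)) ∣q*q∣≡q*q)
    (subst (ℚ._≤ ∣ q ∣ ℚ.* ∣ q ∣) (ℚ.*-zeroˡ 0ℚ)
      (*-mono-≤ ℚ.≤-refl (ℚ.0≤∣p∣ q) ℚ.≤-refl (ℚ.0≤∣p∣ q)))
    where
    open +-*-Solver
    ∣q*q∣≡q*q : ∣ q ℚ.* q ∣ ≡ q ℚ.* q
    ∣q*q∣≡q*q with ℚ.∣p∣≡p∨∣p∣≡-p q
    ... | inj₁ e = trans (ℚ.∣p*q∣≡∣p∣*∣q∣ q q) (cong₂ ℚ._*_ e e)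
    ... | inj₂ e = trans (ℚ.∣p*q∣≡∣p∣*∣q∣ q q) (trans (cong₂ ℚ._*_ e e)
      (solve 1 (λ q → :- q :* :- q := q :* q) refl q))

  -- Null sequences of rationals.

  IsNull : (ℕ → ℚ) → Set
  IsNull f = ∀ ε → 0ℚ ℚ.< ε → ∃ λ N → ∀ {n} → N ℕ.≤ n → ∣ f n ∣ ℚ.< ε

  null-dominated : (∀ n → ∣ f n ∣ ℚ.≤ ∣ g n ∣) → IsNull g → IsNull f
  null-dominated f≤g null ε 0<ε with null ε 0<ε
  ... | N , h = N , λ {n} n≥ → ℚ.≤-<-trans (f≤g n) (h n≥)

  null-resp : (∀ n → f n ≡ g n) → IsNull f → IsNull g
  null-resp f≡g = null-dominated λ n → ℚ.≤-reflexive (cong ∣_∣ (sym (f≡g n)))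

  null-0 : IsNull (λ _ → 0ℚ)
  null-0 ε 0<ε = 0 , λ _ → 0<ε

  null-+ : IsNull f → IsNull g → IsNull (λ n → f n ℚ.+ g n)
  null-+ {f} {g} nf ng ε 0<ε with nf (½ ℚ.* ε) (half-pos 0<ε) | ng (½ ℚ.* ε) (half-pos 0<ε)
  ... | M , hM | N , hN =
    M ℕ.⊔ N , λ {n} n≥ → ∣+∣-< (f n) (g n) (hM (≤-⊔ˡ n≥)) (hN (≤-⊔ʳ M n≥))

  null-neg : IsNull f → IsNull (λ n → ℚ.- f n)
  null-neg {f} = null-dominated λ n → ℚ.≤-reflexive (ℚ.∣-p∣≡∣p∣ (f n))

  -- Past the index `N` that belongs to ε = 1, every term is within 1 of `f N`.
  cauchy⇒bounded : IsCauchy f → ∃ λ K → 0ℚ ℚ.< K × ∃ λ N → ∀ {n} → N ℕ.≤ n → ∣ f n ∣ ℚ.≤ K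
  cauchy⇒bounded {f} cf with cf 1ℚ 0<1
  ... | N , h =
    ∣ f N ∣ ℚ.+ 1ℚ , ℚ.+-mono-≤-< (ℚ.0≤∣p∣ (f N)) 0<1 , N , λ {n} n≥ →
      subst (λ t → ∣ t ∣ ℚ.≤ ∣ f N ∣ ℚ.+ 1ℚ) (rearrange (f N) (f n))
        (ℚ.≤-trans (ℚ.∣p+q∣≤∣p∣+∣q∣ (f N) (f n ℚ.- f N))
          (ℚ.+-monoʳ-≤ ∣ f N ∣ (ℚ.<⇒≤ (h n≥ ℕ.≤-refl))))
    where
    open +-*-Solver
    rearrange : ∀ a b → a ℚ.+ (b ℚ.- a) ≡ b
    rearrange = solve 2 (λ a b → a :+ (b :- a) := b) refl

  -- The sequence `f` is eventually bounded by some `K`, so it suffices that `g` is below ε / K; `r`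
  -- is the reciprocal of `K`.
  null-* : IsCauchy f → IsNull g → IsNull (λ n → f n ℚ.* g n)
  null-* {f} {g} cf ng ε 0<ε =
    let (K , 0<K , M , hM) = cauchy⇒bounded cf
        (r , 0<r , Kr≡1)   = pos-inverse 0<K
        (N , hN)           = ng (r ℚ.* ε) (*-pos 0<r 0<ε)
    in M ℕ.⊔ N , λ {n} n≥ →
         ∣*∣-< 0<K Kr≡1 (f n) (g n) (hM (≤-⊔ˡ n≥)) (hN (≤-⊔ʳ M n≥))

  -- By contraposition: a term of modulus at least ε has a square of modulus at least ε².
  null-sqrt : IsNull (λ n → f n ℚ.* f n) → IsNull f
  null-sqrt {f} nf ε 0<ε with nf (ε ℚ.* ε) (*-pos 0<ε 0<ε)
  ... | N , h = N , λ {n} n≥ → ℚ.≰⇒> λ ε≤ → <⇒≱ (h n≥)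
    (subst (ε ℚ.* ε ℚ.≤_) (sym (ℚ.∣p*q∣≡∣p∣*∣q∣ (f n) (f n)))
      (*-mono-≤ (ℚ.<⇒≤ 0<ε) ε≤ (ℚ.<⇒≤ 0<ε) ε≤))

  -- Equality of real numbers and the ring ℝ.

  ≗⇒≃ : (∀ n → seq x n ≡ seq y n) → x ≃ᴿ y
  ≗⇒≃ {y = y} eq = mk≃ (null-resp (λ n → sym (trans (cong (ℚ._- seq y n) (eq n)) (ℚ.+-inverseʳ (seq y n)))) null-0)

  ≃-refl : x ≃ᴿ x
  ≃-refl = ≗⇒≃ λ _ → refl

  ≃-sym : x ≃ᴿ y → y ≃ᴿ x
  ≃-sym {x} {y} e = mk≃ (null-dominated (λ n → ℚ.≤-reflexive (∣p-q∣≡∣q-p∣ (seq y n) (seq x n))) (close e))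

  ≃-trans : x ≃ᴿ y → y ≃ᴿ z → x ≃ᴿ z
  ≃-trans {x} {y} {z} e e′ = mk≃
    (null-resp (λ n → rearrange (seq x n) (seq y n) (seq z n)) (null-+ (close e) (close e′)))
    where
    open +-*-Solver
    rearrange : ∀ a b c → (a ℚ.- b) ℚ.+ (b ℚ.- c) ≡ a ℚ.- c
    rearrange = solve 3 (λ a b c → (a :- b) :+ (b :- c) := a :- c) refl

  +ᴿ-cong : x ≃ᴿ y → z ≃ᴿ w → x +ᴿ z ≃ᴿ y +ᴿ w
  +ᴿ-cong {x} {y} {z} {w} e e′ = mk≃
    (null-resp (λ n → rearrange (seq x n) (seq y n) (seq z n) (seq w n)) (null-+ (close e) (close e′)))
    where
    open +-*-Solver
    rearrange : ∀ a b c d → (a ℚ.- b) ℚ.+ (c ℚ.- d) ≡ (a ℚ.+ c) ℚ.- (b ℚ.+ d)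
    rearrange = solve 4 (λ a b c d → (a :- b) :+ (c :- d) := (a :+ c) :- (b :+ d)) refl

  -ᴿ-cong : x ≃ᴿ y → -ᴿ x ≃ᴿ -ᴿ y
  -ᴿ-cong {x} {y} e = mk≃ (null-resp (λ n → rearrange (seq x n) (seq y n)) (null-neg (close e)))
    where
    open +-*-Solver
    rearrange : ∀ a b → ℚ.- (a ℚ.- b) ≡ (ℚ.- a) ℚ.- (ℚ.- b)
    rearrange = solve 2 (λ a b → :- (a :- b) := (:- a) :- (:- b)) refl

  -- The difference is x z - y w = x (z - w) + w (x - y), where each summand is a Cauchy sequence
  -- times a null sequence.
  *ᴿ-cong : x ≃ᴿ y → z ≃ᴿ w → x *ᴿ z ≃ᴿ y *ᴿ w
  *ᴿ-cong {x} {y} {z} {w} e e′ = mk≃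
    (null-resp (λ n → rearrange (seq x n) (seq y n) (seq z n) (seq w n))
      (null-+ (null-* {f = seq x} (cauchy x) (close e′)) (null-* {f = seq w} (cauchy w) (close e))))
    where
    open +-*-Solver
    rearrange : ∀ a b c d → a ℚ.* (c ℚ.- d) ℚ.+ d ℚ.* (a ℚ.- b) ≡ a ℚ.* c ℚ.- b ℚ.* d
    rearrange = solve 4 (λ a b c d → a :* (c :- d) :+ d :* (a :- b) := a :* c :- b :* d) refl

  -- All the ring laws hold termwise in ℚ; the ε-estimates are confined to the equivalence and
  -- congruence rules.
  ℝ-commutativeRing : CommutativeRing 0ℓ 0ℓ
  ℝ-commutativeRing = record
    { Carrier = ℝ ; _≈_ = _≃ᴿ_ ; _+_ = _+ᴿ_ ; _*_ = _*ᴿ_ ; -_ = -ᴿ_ ; 0# = 0ᴿ ; 1# = 1ᴿ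
    ; isCommutativeRing = record
      { isRing = record
        { +-isAbelianGroup = record
          { isGroup = record
            { isMonoid = record
              { isSemigroup = record
                { isMagma = record
                  { isEquivalence = record { refl = ≃-refl ; sym = ≃-sym ; trans = ≃-trans }
                  ; ∙-cong = +ᴿ-cong
                  }
                ; assoc = λ x y z → ≗⇒≃ λ n → ℚ.+-assoc (seq x n) (seq y n) (seq z n)
                }
              ; identity = (λ x → ≗⇒≃ λ n → ℚ.+-identityˡ (seq x n))
                         , (λ x → ≗⇒≃ λ n → ℚ.+-identityʳ (seq x n))
              }
            ; inverse = (λ x → ≗⇒≃ λ n → ℚ.+-inverseˡ (seq x n))
                      , (λ x → ≗⇒≃ λ n → ℚ.+-inverseʳ (seq x n))
            ; ⁻¹-cong = -ᴿ-cong
            }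
          ; comm = λ x y → ≗⇒≃ λ n → ℚ.+-comm (seq x n) (seq y n)
          }
        ; *-cong = *ᴿ-cong
        ; *-assoc = λ x y z → ≗⇒≃ λ n → ℚ.*-assoc (seq x n) (seq y n) (seq z n)
        ; *-identity = (λ x → ≗⇒≃ λ n → ℚ.*-identityˡ (seq x n))
                     , (λ x → ≗⇒≃ λ n → ℚ.*-identityʳ (seq x n))
        ; distrib = (λ x y z → ≗⇒≃ λ n → ℚ.*-distribˡ-+ (seq x n) (seq y n) (seq z n))
                  , (λ x y z → ≗⇒≃ λ n → ℚ.*-distribʳ-+ (seq x n) (seq y n) (seq z n))
        }
      ; *-comm = λ x y → ≗⇒≃ λ n → ℚ.*-comm (seq x n) (seq y n)
      }
    }

  -- Vanishing, apartness from zero and inverses in ℝ.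

  ≃0⇒null : x ≃ᴿ 0ᴿ → IsNull (seq x)
  ≃0⇒null {x} e = null-resp (λ n → ℚ.+-identityʳ (seq x n)) (close e)

  null⇒≃0 : IsNull (seq x) → x ≃ᴿ 0ᴿ
  null⇒≃0 {x} null = mk≃ (null-resp (λ n → sym (ℚ.+-identityʳ (seq x n))) null)

  -- Squeezing, used to pass from a vanishing sum of squares to each of its summands.
  ≃0-dominated : (∀ n → 0ℚ ℚ.≤ seq x n) → (∀ n → seq x n ℚ.≤ seq y n) → y ≃ᴿ 0ᴿ → x ≃ᴿ 0ᴿ
  ≃0-dominated 0≤x x≤y y≃0 =
    null⇒≃0 (null-dominated (λ n → ∣∣-mono-≤ (0≤x n) (x≤y n)) (≃0⇒null y≃0))

  square≃0 : x *ᴿ x ≃ᴿ 0ᴿ → x ≃ᴿ 0ᴿ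
  square≃0 e = null⇒≃0 (null-sqrt (≃0⇒null e))

  -- The positive form of being nonzero: it carries the bound δ needed for inversion, which a bare
  -- refutation of `x ≃ᴿ 0ᴿ` does not supply.
  AwayFromZero : ℝ → Set
  AwayFromZero x = ∃ λ δ → 0ℚ ℚ.< δ × ∃ λ N → ∀ {n} → N ℕ.≤ n → δ ℚ.≤ ∣ seq x n ∣

  away⇒≄0 : AwayFromZero x → ¬ x ≃ᴿ 0ᴿ
  away⇒≄0 (δ , 0<δ , M , hM) e with ≃0⇒null e δ 0<δ
  ... | N , hN = <⇒≱ (hN (ℕ.m≤n⊔m M N)) (hM (ℕ.m≤m⊔n M N))

  -- If ∣ x N ∣ is small for N far out then all later terms are small, and otherwise
  -- they all stay away from zero; as the case distinction is on rationals it is decidable.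
  ¬away⇒≃0 : ¬ AwayFromZero x → x ≃ᴿ 0ᴿ
  ¬away⇒≃0 {x} ¬away = null⇒≃0 null
    where
    open +-*-Solver
    rearrange : ∀ a b → a ≡ b ℚ.+ (a ℚ.- b)
    rearrange = solve 2 (λ a b → a := b :+ (a :- b)) refl

    null : IsNull (seq x)
    null ε 0<ε with cauchy x (½ ℚ.* (½ ℚ.* ε)) (half-pos (half-pos 0<ε))
    ... | N , h with ∣ seq x N ∣ ℚ.<? ½ ℚ.* ε
    ... | yes small = N , λ {n} n≥ → subst (λ t → ∣ t ∣ ℚ.< ε) (sym (rearrange (seq x n) (seq x N)))
          (∣+∣-< (seq x N) (seq x n ℚ.- seq x N) small
            (ℚ.<-trans (h n≥ ℕ.≤-refl) (subst (½ ℚ.* (½ ℚ.* ε) ℚ.<_) (half+half _)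
              (subst (ℚ._< ½ ℚ.* (½ ℚ.* ε) ℚ.+ ½ ℚ.* (½ ℚ.* ε)) (ℚ.+-identityʳ _)
                (ℚ.+-monoʳ-< (½ ℚ.* (½ ℚ.* ε)) (half-pos (half-pos 0<ε)))))))
    ... | no large = contradiction
          (½ ℚ.* (½ ℚ.* ε) , half-pos (half-pos 0<ε) , N , λ {n} n≥ →
            ℚ.≮⇒≥ λ x<  → large (subst (λ t → ∣ t ∣ ℚ.< ½ ℚ.* ε) (sym (rearrange (seq x N) (seq x n)))
              (∣+∣-< (seq x n) (seq x N ℚ.- seq x n) x< (h ℕ.≤-refl n≥))))
          ¬away

  -- Vanishing is equivalent to the negation of `AwayFromZero`, and negations are stable.
  ≃0-stable : ¬ ¬ x ≃ᴿ 0ᴿ → x ≃ᴿ 0ᴿ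
  ≃0-stable ¬¬e = ¬away⇒≃0 λ away → ¬¬e (away⇒≄0 away)

  -- Vanishing may be proved by refuting apartness. So `x` may be assumed away from zero, and then,
  -- to contradict `y≄0`, `y` may be too; but a product of two such numbers is away from zero.
  *ᴿ-cancelʳ-0 : x *ᴿ y ≃ᴿ 0ᴿ → ¬ y ≃ᴿ 0ᴿ → x ≃ᴿ 0ᴿ
  *ᴿ-cancelʳ-0 {x} {y} xy≃0 y≄0 = ¬away⇒≃0 λ awayˣ → y≄0 (¬away⇒≃0 λ awayʸ → away⇒≄0 (away-* awayˣ awayʸ) xy≃0)
    where
    away-* : AwayFromZero x → AwayFromZero y → AwayFromZero (x *ᴿ y)
    away-* (δ , 0<δ , M , hM) (ε , 0<ε , N , hN) =
      δ ℚ.* ε , *-pos 0<δ 0<ε , M ℕ.⊔ N , λ {n} n≥ →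
        subst (δ ℚ.* ε ℚ.≤_) (sym (ℚ.∣p*q∣≡∣p∣*∣q∣ (seq x n) (seq y n)))
          (*-mono-≤ (ℚ.<⇒≤ 0<δ) (hM (≤-⊔ˡ n≥)) (ℚ.<⇒≤ 0<ε) (hN (≤-⊔ʳ M n≥)))

  away⇒invertible : AwayFromZero x → ∃ λ y → x *ᴿ y ≃ᴿ 1ᴿ
  away⇒invertible {x} (δ , 0<δ , N , h) = x⁻¹ , mk≃ λ ε 0<ε →
    let (M , hM) = cauchy x (δ ℚ.* ε) (*-pos 0<δ 0<ε)
    in M , λ {n} n≥ → subst (λ t → ∣ t ∣ ℚ.< ε) (sym (product (seq x n) (u n) (v n) (uv≡1 n)))
         (∣*∣-< 0<K Kδ≡1 (v n) (seq x n ℚ.- u n) (v≤K n) (hM n≥ (ℕ.≤-trans n≥ (ℕ.m≤n+m n N))))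
    where
    open +-*-Solver

    K : ℚ
    K = let (K , _) = pos-inverse 0<δ in K
    0<K : 0ℚ ℚ.< K
    0<K = let (_ , 0<K , _) = pos-inverse 0<δ in 0<K
    Kδ≡1 : K ℚ.* δ ≡ 1ℚ
    Kδ≡1 = let (_ , _ , e) = pos-inverse 0<δ in trans (ℚ.*-comm K δ) e

    -- The shift by `N` skips the terms that may vanish, so that every reciprocal `v n` exists and
    -- is bounded by `K` = 1 / δ.
    u : ℕ → ℚ
    u n = seq x (N ℕ.+ n)

    δ≤∣u∣ : ∀ n → δ ℚ.≤ ∣ u n ∣
    δ≤∣u∣ n = h (ℕ.m≤m+n N n)

    u≢0 : ∀ n → u n ≢ 0ℚ
    u≢0 n u≡0 = <⇒≱ 0<δ (subst (λ t → δ ℚ.≤ ∣ t ∣) u≡0 (δ≤∣u∣ n))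

    v : ℕ → ℚ
    v n = (ℚ.1/ u n) {{ℚ.≢-nonZero (u≢0 n)}}

    uv≡1 : ∀ n → u n ℚ.* v n ≡ 1ℚ
    uv≡1 n = ℚ.*-inverseʳ (u n) {{ℚ.≢-nonZero (u≢0 n)}}

    v≤K : ∀ n → ∣ v n ∣ ℚ.≤ K
    v≤K n = subst₂ ℚ._≤_ left (ℚ.*-identityʳ K)
      (ℚ.*-monoˡ-≤-nonNeg K {{ℚ.nonNegative (ℚ.<⇒≤ 0<K)}}
        (subst (δ ℚ.* ∣ v n ∣ ℚ.≤_) right
          (ℚ.*-monoʳ-≤-nonNeg ∣ v n ∣ {{ℚ.nonNegative (ℚ.0≤∣p∣ (v n))}} (δ≤∣u∣ n))))
      where
      left : K ℚ.* (δ ℚ.* ∣ v n ∣) ≡ ∣ v n ∣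
      left = trans (sym (ℚ.*-assoc K δ ∣ v n ∣))
        (trans (cong (ℚ._* ∣ v n ∣) Kδ≡1) (ℚ.*-identityˡ ∣ v n ∣))
      right : ∣ u n ∣ ℚ.* ∣ v n ∣ ≡ 1ℚ
      right = trans (sym (ℚ.∣p*q∣≡∣p∣*∣q∣ (u n) (v n))) (cong ∣_∣ (uv≡1 n))

    -- For b = `u n` and c = `v n`, this reduces the error at index n to the difference of the terms
    -- of `x` at n and at N + n, which is small by the Cauchy property.
    product : ∀ a b c → b ℚ.* c ≡ 1ℚ → a ℚ.* c ℚ.- 1ℚ ≡ c ℚ.* (a ℚ.- b)
    product a b c bc≡1 = trans (cong (λ t → a ℚ.* c ℚ.- t) (sym bc≡1))
      (solve 3 (λ a b c → a :* c :- b :* c := c :* (a :- b)) refl a b c)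

    -- The identity 1/a - 1/b = (b - a) / (a b) without division.
    difference : ∀ a b c d → a ℚ.* c ≡ 1ℚ → b ℚ.* d ≡ 1ℚ → c ℚ.- d ≡ c ℚ.* (d ℚ.* (b ℚ.- a))
    difference a b c d ac≡1 bd≡1 = trans
      (cong₂ ℚ._-_ (trans (sym (ℚ.*-identityʳ c)) (cong (c ℚ.*_) (sym bd≡1)))
                   (trans (sym (ℚ.*-identityʳ d)) (cong (d ℚ.*_) (sym ac≡1))))
      (solve 4 (λ a b c d → c :* (b :* d) :- d :* (a :* c) := c :* (d :* (b :- a))) refl a b c d)

    x⁻¹ : ℝ
    seq    x⁻¹ = v
    cauchy x⁻¹ ε 0<ε =
      -- One factor δ compensates for each of the two reciprocals in `difference`, both bounded by 1
      -- / δ.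
      let (M , hM) = cauchy x (δ ℚ.* (δ ℚ.* ε)) (*-pos 0<δ (*-pos 0<δ 0<ε))
      in M , λ {m} {n} m≥ n≥ →
        subst (λ t → ∣ t ∣ ℚ.< ε) (sym (difference (u m) (u n) (v m) (v n) (uv≡1 m) (uv≡1 n)))
          (∣*∣-< 0<K Kδ≡1 (v m) (v n ℚ.* (u n ℚ.- u m)) (v≤K m)
            (∣*∣-< 0<K Kδ≡1 (v n) (u n ℚ.- u m) (v≤K n)
              (hM (ℕ.≤-trans n≥ (ℕ.m≤n+m n N)) (ℕ.≤-trans m≥ (ℕ.m≤n+m m N)))))

  -- If `y` came within δ/2 of zero while `x` and `y` differ by less than δ/2, then `x` would come
  -- within δ of zero.
  away-resp-≃ : AwayFromZero x → x ≃ᴿ y → AwayFromZero y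
  away-resp-≃ {x} {y} (δ , 0<δ , M , hM) e with close e (½ ℚ.* δ) (half-pos 0<δ)
  ... | N , hN = ½ ℚ.* δ , half-pos 0<δ , M ℕ.⊔ N , λ {n} n≥ → ℚ.≮⇒≥ λ y< →
    <⇒≱ (subst (λ t → ∣ t ∣ ℚ.< δ) (rearrange (seq x n) (seq y n))
          (∣+∣-< (seq y n) (seq x n ℚ.- seq y n) y< (hN (≤-⊔ʳ M n≥))))
        (hM (≤-⊔ˡ n≥))
    where
    open +-*-Solver
    rearrange : ∀ a b → b ℚ.+ (a ℚ.- b) ≡ a
    rearrange = solve 2 (λ a b → b :+ (a :- b) := a) refl

  away-dominating : (∀ n → 0ℚ ℚ.≤ seq x n) → (∀ n → seq x n ℚ.≤ seq y n) → AwayFromZero x → AwayFromZero y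
  away-dominating 0≤x x≤y (δ , 0<δ , N , h) =
    δ , 0<δ , N , λ {n} n≥ → ℚ.≤-trans (h n≥) (∣∣-mono-≤ (0≤x n) (x≤y n))

  1-away : AwayFromZero 1ᴿ
  1-away = 1ℚ , 0<1 , 0 , λ _ → ℚ.≤-refl

-- Matrices over a commutative ring

module MatrixAlgebra {r ℓ} (R : CommutativeRing r ℓ) where
  open CommutativeRing R hiding (zero)
  open MatrixOperations rawRing public
  open SemiringSum semiring public
  open SemiringSolver commutativeSemiring using (solve; _:=_; _:+_; _:*_; con)

  private
    variable
      l m n o : ℕ

  -- Sums with few nonzero terms, and the identity matrix.

  sum-zero : (v : Vector Carrier n) → (∀ i → v i ≈ 0#) → sum v ≈ 0#
  sum-zero {n} v v≈0 = trans (sum-cong-≋ v≈0) (sum-replicate-zero n)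

  sum-single : ∀ (v : Vector Carrier n) i → (∀ j → j ≢ i → v j ≈ 0#) → sum v ≈ v i
  sum-single {suc n} v i v≈0 = trans (sum-remove v)
    (trans (+-congˡ (sum-zero (removeAt v i) λ j → v≈0 _ (Fin.punchInᵢ≢i i j))) (+-identityʳ _))

  identity-diag : ∀ i → identity n i i ≡ 1#
  identity-diag i with i Fin.≟ i
  ... | yes _   = ≡.refl
  ... | no i≢i = contradiction ≡.refl i≢i

  identity-off-diag : ∀ {i j : Fin n} → i ≢ j → identity n i j ≡ 0#
  identity-off-diag {i = i} {j} i≢j with i Fin.≟ j
  ... | yes i≡j = contradiction i≡j i≢j
  ... | no _    = ≡.refl

  -- Laws of the matrix operations.

  ≋-setoid : ℕ → ℕ → Setoid r ℓ
  ≋-setoid m n = record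
    { Carrier = Matrix Carrier m n
    ; _≈_ = _≋_
    ; isEquivalence = record
      { refl  = λ _ _ → refl
      ; sym   = λ p i j → sym (p i j)
      ; trans = λ p q i j → trans (p i j) (q i j)
      }
    }

  module _ {m n : ℕ} where
    open Setoid (≋-setoid m n) public using () renaming (refl to ≋-refl; sym to ≋-sym; trans to ≋-trans)

  ⊕-cong : ∀ {A A′ B B′ : Matrix Carrier m n} → A ≋ A′ → B ≋ B′ → A ⊕ B ≋ A′ ⊕ B′
  ⊕-cong p q i j = +-cong (p i j) (q i j)

  ·-cong : ∀ {x y} {A B : Matrix Carrier m n} → x ≈ y → A ≋ B → x · A ≋ y · B
  ·-cong p q i j = *-cong p (q i j)

  ⊗-cong : ∀ {A A′ : Matrix Carrier l m} {B B′ : Matrix Carrier m n} →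
           A ≋ A′ → B ≋ B′ → A ⊗ B ≋ A′ ⊗ B′
  ⊗-cong p q i k = sum-cong-≋ λ j → *-cong (p i j) (q j k)

  ⊗-congˡ : ∀ (A : Matrix Carrier l m) {B B′ : Matrix Carrier m n} → B ≋ B′ → A ⊗ B ≋ A ⊗ B′
  ⊗-congˡ A = ⊗-cong (≋-refl {x = A})

  ⊗-congʳ : ∀ {A A′ : Matrix Carrier l m} (B : Matrix Carrier m n) → A ≋ A′ → A ⊗ B ≋ A′ ⊗ B
  ⊗-congʳ B p = ⊗-cong p (≋-refl {x = B})

  ⊗-assoc : ∀ (A : Matrix Carrier l m) (B : Matrix Carrier m n) (C : Matrix Carrier n o) →
            (A ⊗ B) ⊗ C ≋ A ⊗ (B ⊗ C)
  ⊗-assoc {m = m} {n} A B C i k = begin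
    ∑[ q < n ] (∑[ p < m ] (A i p * B p q) * C q k)
      ≈⟨ sum-cong-≋ (λ q → trans (*-distribʳ-sum (C q k) (λ p → A i p * B p q))
           (sum-cong-≋ λ p → *-assoc (A i p) (B p q) (C q k))) ⟩
    ∑[ q < n ] ∑[ p < m ] (A i p * (B p q * C q k))
      ≈⟨ ∑-comm (λ q p → A i p * (B p q * C q k)) ⟩
    ∑[ p < m ] ∑[ q < n ] (A i p * (B p q * C q k))
      ≈⟨ sum-cong-≋ (λ p → *-distribˡ-sum (A i p) (λ q → B p q * C q k)) ⟨
    ∑[ p < m ] (A i p * ∑[ q < n ] (B p q * C q k)) ∎
    where open SetoidReasoning setoid

  ·-⊗ : ∀ x (A : Matrix Carrier l m) (B : Matrix Carrier m n) → (x · A) ⊗ B ≋ x · (A ⊗ B)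
  ·-⊗ x A B i k = trans (sum-cong-≋ λ j → *-assoc x (A i j) (B j k))
    (sym (*-distribˡ-sum x λ j → A i j * B j k))

  ⊗-· : ∀ x (A : Matrix Carrier l m) (B : Matrix Carrier m n) → A ⊗ (x · B) ≋ x · (A ⊗ B)
  ⊗-· x A B i k = trans
    (sum-cong-≋ λ j → solve 3 (λ x a b → a :* (x :* b) := x :* (a :* b)) refl x (A i j) (B j k))
    (sym (*-distribˡ-sum x λ j → A i j * B j k))

  ⊗-distribˡ-⊕ : ∀ (A : Matrix Carrier l m) (B C : Matrix Carrier m n) →
                 A ⊗ (B ⊕ C) ≋ A ⊗ B ⊕ A ⊗ C
  ⊗-distribˡ-⊕ A B C i k = trans (sum-cong-≋ λ j → distribˡ (A i j) (B j k) (C j k))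
    (∑-distrib-+ (λ j → A i j * B j k) (λ j → A i j * C j k))

  ⊗-distribʳ-⊕ : ∀ (A B : Matrix Carrier l m) (C : Matrix Carrier m n) →
                 (A ⊕ B) ⊗ C ≋ A ⊗ C ⊕ B ⊗ C
  ⊗-distribʳ-⊕ A B C i k = trans (sum-cong-≋ λ j → distribʳ (C j k) (A i j) (B i j))
    (∑-distrib-+ (λ j → A i j * C j k) (λ j → B i j * C j k))

  ⊗-identityˡ : (A : Matrix Carrier m n) → identity m ⊗ A ≋ A
  ⊗-identityˡ A i k = trans
    (sum-single _ i λ j j≢i →
      trans (*-congʳ (reflexive (identity-off-diag (j≢i ∘ ≡.sym)))) (zeroˡ (A j k)))
    (trans (*-congʳ (reflexive (identity-diag i))) (*-identityˡ (A i k)))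

  ⊗-identityʳ : (A : Matrix Carrier m n) → A ⊗ identity n ≋ A
  ⊗-identityʳ A i k = trans
    (sum-single _ k λ j j≢k →
      trans (*-congˡ (reflexive (identity-off-diag j≢k))) (zeroʳ (A i j)))
    (trans (*-congˡ (reflexive (identity-diag k))) (*-identityʳ (A i k)))

  ⊗-zeroʳ : ∀ (A : Matrix Carrier l m) {B : Matrix Carrier m n} →
            B ≋ (λ _ _ → 0#) → A ⊗ B ≋ (λ _ _ → 0#)
  ⊗-zeroʳ A B≋0 i k = sum-zero _ λ j → trans (*-congˡ (B≋0 j k)) (zeroʳ (A i j))

  -- Vectors are treated as one-column matrices so that the laws of `⊗` apply to matrix-vector
  -- products.
  column : Vector Carrier n → Matrix Carrier n 1
  column v i _ = v i

  -- This is G² = p G + (t - p) I, with the negative term moved to the left so that it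
  -- is a semiring identity.
  quadratic : ∀ {S : Matrix Carrier n n} {a b} μ → S ⊗ S ≋ a · identity n ⊕ b · S →
              let G = identity n ⊕ μ · S
                  p = 1# + 1# + μ * b
                  t = 1# + μ * (μ * a)
              in G ⊗ G ⊕ p · identity n ≋ p · G ⊕ t · identity n
  quadratic {n} {S} {a} {b} μ S² i j = trans (+-congʳ (square i j))
    (solve 5 (λ e s μ a b →
        let p = con 1 :+ con 1 :+ μ :* b ; t = con 1 :+ μ :* (μ :* a) in
        (e :+ μ :* s) :+ μ :* (s :+ μ :* (a :* e :+ b :* s)) :+ p :* e
          := p :* (e :+ μ :* s) :+ t :* e)
      refl (identity n i j) (S i j) μ a b)
    where
    I G : Matrix Carrier n n
    I = identity n
    G = I ⊕ μ · S

    open SetoidReasoning (≋-setoid n n)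

    square : G ⊗ G ≋ G ⊕ μ · (S ⊕ μ · (a · I ⊕ b · S))
    square = begin
      G ⊗ G                                ≈⟨ ⊗-distribʳ-⊕ I (μ · S) G ⟩
      I ⊗ G ⊕ (μ · S) ⊗ G                  ≈⟨ ⊕-cong (⊗-identityˡ G) (·-⊗ μ S G) ⟩
      G ⊕ μ · (S ⊗ G)                      ≈⟨ ⊕-cong (≋-refl {x = G}) (·-cong refl (⊗-distribˡ-⊕ S I (μ · S))) ⟩
      G ⊕ μ · (S ⊗ I ⊕ S ⊗ (μ · S))        ≈⟨ ⊕-cong (≋-refl {x = G}) (·-cong refl (⊕-cong (⊗-identityʳ S) (⊗-· μ S S))) ⟩
      G ⊕ μ · (S ⊕ μ · (S ⊗ S))            ≈⟨ ⊕-cong (≋-refl {x = G}) (·-cong refl (⊕-cong (≋-refl {x = S}) (·-cong refl S²))) ⟩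
      G ⊕ μ · (S ⊕ μ · (a · I ⊕ b · S))    ∎

  -- Kernel vectors by division-free elimination.

  module _ (1≉0 : ¬ 1# ≈ 0#)
           (≈0-stable : ∀ {x} → ¬ ¬ x ≈ 0# → x ≈ 0#)
           (cancelʳ-0 : ∀ {x y} → x * y ≈ 0# → ¬ y ≈ 0# → x ≈ 0#) where

    -- Induction on the number of rows. As the goal is a negation, it may be decided whether the
    -- first row has a nonzero entry. If not, that row is dropped; otherwise the entry is a pivot,
    -- and eliminating its column leaves one row and one column less.
    ¬¬-kernel : (A : Matrix Carrier m n) → m ℕ.< n →
                ¬ ¬ ∃ λ (v : Vector Carrier n) →
                  (∃ λ (i : Fin n) → ¬ v i ≈ 0#) × ∀ k → sum (λ j → A k j * v j) ≈ 0#
    ¬¬-kernel {zero}  {suc n} A _         ¬ker = ¬ker ((λ _ → 1#) , (zero , 1≉0) , λ ())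
    ¬¬-kernel {suc m} {suc n} A (s≤s m<n) ¬ker = ¬¬-excluded-middle λ where
        (no  none)       → ¬¬-kernel (A ∘ suc) (ℕ.m≤n⇒m≤1+n m<n) λ (v , v≉0 , Av≈0) →
          ¬ker (v , v≉0 , λ where
            -- No entry of the first row is nonzero, so by stability they all vanish.
            zero    → sum-zero _ λ j → trans (*-congʳ (≈0-stable λ x≉0 → none (j , x≉0))) (zeroˡ (v j))
            (suc k) → Av≈0 k)
        (yes (j , x≉0)) → ¬¬-kernel (λ k → minor j (A (suc k))) m<n λ (v , (i , v≉0) , Mv≈0) →
          -- The entry of the lift at `punchIn j i` is `x j * v i`, a product of nonzero factors.
          ¬ker (lift j v , (punchIn j i , λ lift≈0 →
                 x≉0 (cancelʳ-0 (trans (reflexive (≡.sym (insertAt-punchIn (λ i → x j * v i) j _ i))) lift≈0) v≉0)) , λ where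
            zero    → trans (lift-minor j v x) (sum-zero _ λ i → trans (*-congʳ (minor-x j i)) (zeroˡ (v i)))
            (suc k) → trans (lift-minor j v (A (suc k))) (Mv≈0 k))
      where
      open RingProperties ring using (-‿distribˡ-*)

      x : Vector Carrier (suc n)
      x = A zero

      -- The 2 × 2 minors of the rows `x` and `a` that involve column `j`: they eliminate that
      -- column without dividing by the pivot `x j`.
      minor : Fin (suc n) → Vector Carrier (suc n) → Vector Carrier n
      minor j a i = x j * a (punchIn j i) + - x (punchIn j i) * a j

      minor-x : ∀ j i → minor j x i ≈ 0#
      minor-x j i = trans
        (+-cong (*-comm (x j) _) (sym (-‿distribˡ-* _ (x j)))) (-‿inverseʳ _)

      -- Entry `j` is chosen to solve the equation of the row `x`; the other entries are multiplied
      -- by `x j`, which spares the division.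
      lift : Fin (suc n) → Vector Carrier n → Vector Carrier (suc n)
      lift j v = insertAt (λ i → x j * v i) j (sum λ i → - x (punchIn j i) * v i)

      -- For a = `x` the minors vanish, which gives the pivot equation; for any other row this is
      -- the corresponding equation of the reduced system.
      lift-minor : ∀ j v a → sum (λ l → a l * lift j v l) ≈ sum (λ i → minor j a i * v i)
      lift-minor j v a = begin
        sum (λ l → a l * lift j v l)
          ≈⟨ sum-remove {i = j} (λ l → a l * lift j v l) ⟩
        a j * lift j v j + sum (λ i → a (punchIn j i) * lift j v (punchIn j i))
          ≈⟨ +-cong (*-congˡ (reflexive (insertAt-lookup xv j (sum yv))))
               (sum-cong-≋ λ i → *-congˡ (reflexive (insertAt-punchIn xv j (sum yv) i))) ⟩
        a j * sum yv + sum (λ i → a (punchIn j i) * xv i)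
          ≈⟨ +-congʳ (*-distribˡ-sum (a j) yv) ⟩
        sum (λ i → a j * yv i) + sum (λ i → a (punchIn j i) * xv i)
          ≈⟨ ∑-distrib-+ (λ i → a j * yv i) (λ i → a (punchIn j i) * xv i) ⟨
        sum (λ i → a j * yv i + a (punchIn j i) * xv i)
          ≈⟨ sum-cong-≋ (λ i → solve 5 (λ aj y v ai xj →
               aj :* (y :* v) :+ ai :* (xj :* v) := (xj :* ai :+ y :* aj) :* v)
               refl (a j) (- x (punchIn j i)) (v i) (a (punchIn j i)) (x j)) ⟩
        sum (λ i → minor j a i * v i) ∎
        where
        xv yv : Vector Carrier n
        xv i = x j * v i
        yv i = - x (punchIn j i) * v i
        open SetoidReasoning setoid

-- Complex numbers and matrices

open Reals

private
  module ℝR = CommutativeRing ℝ-commutativeRing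
  variable
    z w : ℂ
    d m n D : ℕ

open MonoidSum ℝR.+-monoid using () renaming (sum to sumᴿ)

-- The ring ℂ.

+ᶜ-cong : ∀ {z z′ w w′} → z ≃ᶜ z′ → w ≃ᶜ w′ → z +ᶜ w ≃ᶜ z′ +ᶜ w′
+ᶜ-cong e e′ = mk≃ᶜ (+ᴿ-cong (re≃ e) (re≃ e′)) (+ᴿ-cong (im≃ e) (im≃ e′))

*ᶜ-cong : ∀ {z z′ w w′} → z ≃ᶜ z′ → w ≃ᶜ w′ → z *ᶜ w ≃ᶜ z′ *ᶜ w′
*ᶜ-cong e e′ = mk≃ᶜ
  (+ᴿ-cong (*ᴿ-cong (re≃ e) (re≃ e′)) (-ᴿ-cong (*ᴿ-cong (im≃ e) (im≃ e′))))
  (+ᴿ-cong (*ᴿ-cong (re≃ e) (im≃ e′)) (*ᴿ-cong (im≃ e) (re≃ e′)))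

-- The laws that involve products become, by `≗⇒≃`, polynomial identities between the rational terms
-- of the real and imaginary parts.
ℂ-commutativeRing : CommutativeRing 0ℓ 0ℓ
ℂ-commutativeRing = record
  { Carrier = ℂ ; _≈_ = _≃ᶜ_ ; _+_ = _+ᶜ_ ; _*_ = _*ᶜ_ ; -_ = -ᶜ_ ; 0# = fromℝ 0ᴿ ; 1# = fromℝ 1ᴿ
  ; isCommutativeRing = record
    { isRing = record
      { +-isAbelianGroup = record
        { isGroup = record
          { isMonoid = record
            { isSemigroup = record
              { isMagma = record
                { isEquivalence = record
                  { refl = mk≃ᶜ ℝR.refl ℝR.refl
                  ; sym = λ e → mk≃ᶜ (ℝR.sym (re≃ e)) (ℝR.sym (im≃ e))
                  ; trans = λ e e′ → mk≃ᶜ (ℝR.trans (re≃ e) (re≃ e′)) (ℝR.trans (im≃ e) (im≃ e′))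
                  }
                ; ∙-cong = +ᶜ-cong
                }
              ; assoc = λ x y z → mk≃ᶜ (ℝR.+-assoc (re x) (re y) (re z)) (ℝR.+-assoc (im x) (im y) (im z))
              }
            ; identity = (λ x → mk≃ᶜ (ℝR.+-identityˡ (re x)) (ℝR.+-identityˡ (im x)))
                       , (λ x → mk≃ᶜ (ℝR.+-identityʳ (re x)) (ℝR.+-identityʳ (im x)))
            }
          ; inverse = (λ x → mk≃ᶜ (ℝR.-‿inverseˡ (re x)) (ℝR.-‿inverseˡ (im x)))
                    , (λ x → mk≃ᶜ (ℝR.-‿inverseʳ (re x)) (ℝR.-‿inverseʳ (im x)))
          ; ⁻¹-cong = λ e → mk≃ᶜ (-ᴿ-cong (re≃ e)) (-ᴿ-cong (im≃ e))
          }
        ; comm = λ x y → mk≃ᶜ (ℝR.+-comm (re x) (re y)) (ℝR.+-comm (im x) (im y))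
        }
      ; *-cong = *ᶜ-cong
      ; *-assoc = λ x y z → mk≃ᶜ
          (≗⇒≃ λ n → solve 6 (λ a b c d e f →
              (a :* c :- b :* d) :* e :- (a :* d :+ b :* c) :* f
                := a :* (c :* e :- d :* f) :- b :* (c :* f :+ d :* e))
            ≡.refl (seq (re x) n) (seq (im x) n) (seq (re y) n) (seq (im y) n) (seq (re z) n) (seq (im z) n))
          (≗⇒≃ λ n → solve 6 (λ a b c d e f →
              (a :* c :- b :* d) :* f :+ (a :* d :+ b :* c) :* e
                := a :* (c :* f :+ d :* e) :+ b :* (c :* e :- d :* f))
            ≡.refl (seq (re x) n) (seq (im x) n) (seq (re y) n) (seq (im y) n) (seq (re z) n) (seq (im z) n))
      ; *-identity = *ᶜ-identityˡ , λ x → mk≃ᶜ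
          (ℝR.trans (re≃ (*ᶜ-comm x (fromℝ 1ᴿ))) (re≃ (*ᶜ-identityˡ x)))
          (ℝR.trans (im≃ (*ᶜ-comm x (fromℝ 1ᴿ))) (im≃ (*ᶜ-identityˡ x)))
      ; distrib =
          (λ x y z → mk≃ᶜ
            (≗⇒≃ λ n → solve 6 (λ a b c d e f →
                a :* (c :+ e) :- b :* (d :+ f) := (a :* c :- b :* d) :+ (a :* e :- b :* f))
              ≡.refl (seq (re x) n) (seq (im x) n) (seq (re y) n) (seq (im y) n) (seq (re z) n) (seq (im z) n))
            (≗⇒≃ λ n → solve 6 (λ a b c d e f →
                a :* (d :+ f) :+ b :* (c :+ e) := (a :* d :+ b :* c) :+ (a :* f :+ b :* e))
              ≡.refl (seq (re x) n) (seq (im x) n) (seq (re y) n) (seq (im y) n) (seq (re z) n) (seq (im z) n)))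
        , (λ x y z → mk≃ᶜ
            (≗⇒≃ λ n → solve 6 (λ a b c d e f →
                (c :+ e) :* a :- (d :+ f) :* b := (c :* a :- d :* b) :+ (e :* a :- f :* b))
              ≡.refl (seq (re x) n) (seq (im x) n) (seq (re y) n) (seq (im y) n) (seq (re z) n) (seq (im z) n))
            (≗⇒≃ λ n → solve 6 (λ a b c d e f →
                (c :+ e) :* b :+ (d :+ f) :* a := (c :* b :+ d :* a) :+ (e :* b :+ f :* a))
              ≡.refl (seq (re x) n) (seq (im x) n) (seq (re y) n) (seq (im y) n) (seq (re z) n) (seq (im z) n)))
      }
    ; *-comm = *ᶜ-comm
    }
  }
  where
  open +-*-Solver

  *ᶜ-comm : ∀ z w → z *ᶜ w ≃ᶜ w *ᶜ z
  *ᶜ-comm z w = mk≃ᶜ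
    (≗⇒≃ λ n → solve 4 (λ a b c d → a :* c :- b :* d := c :* a :- d :* b) ≡.refl
      (seq (re z) n) (seq (im z) n) (seq (re w) n) (seq (im w) n))
    (≗⇒≃ λ n → solve 4 (λ a b c d → a :* d :+ b :* c := c :* b :+ d :* a) ≡.refl
      (seq (re z) n) (seq (im z) n) (seq (re w) n) (seq (im w) n))

  *ᶜ-identityˡ : ∀ z → fromℝ 1ᴿ *ᶜ z ≃ᶜ z
  *ᶜ-identityˡ z = mk≃ᶜ
    (≗⇒≃ λ n → solve 2 (λ a b → con 1ℚ :* a :- con 0ℚ :* b := a) ≡.refl (seq (re z) n) (seq (im z) n))
    (≗⇒≃ λ n → solve 2 (λ a b → con 1ℚ :* b :+ con 0ℚ :* a := b) ≡.refl (seq (re z) n) (seq (im z) n))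

open CommutativeRing ℂ-commutativeRing hiding (zero)
open GroupProperties +-group using () renaming (x∙y⁻¹≈ε⇒x≈y to x-y≈0⇒x≈y)
open RingProperties ring using (-‿distribˡ-*; +-cancelʳ; [y-z]x≈yx-zx)
open MatrixAlgebra ℂ-commutativeRing

-- The embedding of ℝ and conjugation.

fromℝ-cong : ∀ {x y} → x ≃ᴿ y → fromℝ x ≈ fromℝ y
fromℝ-cong e = mk≃ᶜ e ℝR.refl

fromℝ-* : ∀ x y → fromℝ x * fromℝ y ≈ fromℝ (x *ᴿ y)
fromℝ-* x y = mk≃ᶜ
  (≗⇒≃ λ n → solve 2 (λ a b → a :* b :- con 0ℚ :* con 0ℚ := a :* b) ≡.refl (seq x n) (seq y n))
  (≗⇒≃ λ n → solve 2 (λ a b → a :* con 0ℚ :+ con 0ℚ :* b := con 0ℚ) ≡.refl (seq x n) (seq y n))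
  where open +-*-Solver

conj-involutive : ∀ z → conj (conj z) ≈ z
conj-involutive z = mk≃ᶜ ℝR.refl
  (≗⇒≃ λ n → solve 1 (λ a → :- (:- a) := a) ≡.refl (seq (im z) n))
  where open +-*-Solver

conj-fromℝ : ∀ x → conj (fromℝ x) ≈ fromℝ x
conj-fromℝ x = mk≃ᶜ ℝR.refl (≗⇒≃ λ _ → ≡.refl)

conj-+ : ∀ z w → conj (z + w) ≈ conj z + conj w
conj-+ z w = mk≃ᶜ ℝR.refl (≗⇒≃ λ n →
  solve 2 (λ a b → :- (a :+ b) := :- a :+ :- b) ≡.refl (seq (im z) n) (seq (im w) n))
  where open +-*-Solver

conj-* : ∀ z w → conj (z * w) ≈ conj z * conj w
conj-* z w = mk≃ᶜ
  (≗⇒≃ λ n → solve 4 (λ a b c d → a :* c :- b :* d := a :* c :- (:- b) :* (:- d)) ≡.refl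
    (seq (re z) n) (seq (im z) n) (seq (re w) n) (seq (im w) n))
  (≗⇒≃ λ n → solve 4 (λ a b c d → :- (a :* d :+ b :* c) := a :* :- d :+ :- b :* c) ≡.refl
    (seq (re z) n) (seq (im z) n) (seq (re w) n) (seq (im w) n))
  where open +-*-Solver

conj-sum : ∀ {n} (v : Vector ℂ n) → conj (sum v) ≈ sum (conj ∘ v)
conj-sum {zero}  v = conj-fromℝ 0ᴿ
conj-sum {suc n} v = trans (conj-+ (v zero) (sum (v ∘ suc))) (+-congˡ (conj-sum (v ∘ suc)))

conj-*-self : ∀ z → conj z * z ≈ fromℝ ∣ z ∣²
conj-*-self z = mk≃ᶜ
  (≗⇒≃ λ n → solve 2 (λ a b → a :* a :- (:- b) :* b := a :* a :+ b :* b) ≡.refl (seq (re z) n) (seq (im z) n))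
  (≗⇒≃ λ n → solve 2 (λ a b → a :* b :+ (:- b) :* a := con 0ℚ) ≡.refl (seq (re z) n) (seq (im z) n))
  where open +-*-Solver

-- Squared moduli and vanishing in ℂ.

∣∣²-cong : z ≈ w → ∣ z ∣² ≃ᴿ ∣ w ∣²
∣∣²-cong e = +ᴿ-cong (*ᴿ-cong (re≃ e) (re≃ e)) (*ᴿ-cong (im≃ e) (im≃ e))

∣1∣²≃1 : ∣ 1# ∣² ≃ᴿ 1ᴿ
∣1∣²≃1 = ≗⇒≃ λ _ → ≡.refl

∣∣²-* : ∀ z w → ∣ z * w ∣² ≃ᴿ ∣ z ∣² *ᴿ ∣ w ∣²
∣∣²-* z w = ≗⇒≃ λ n → solve 4 (λ a b c d →
    (a :* c :- b :* d) :* (a :* c :- b :* d) :+ (a :* d :+ b :* c) :* (a :* d :+ b :* c)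
      := (a :* a :+ b :* b) :* (c :* c :+ d :* d))
  ≡.refl (seq (re z) n) (seq (im z) n) (seq (re w) n) (seq (im w) n)
  where open +-*-Solver

∣∣²-nonneg : ∀ z n → 0ℚ ℚ.≤ seq ∣ z ∣² n
∣∣²-nonneg z n = ℚ.+-mono-≤ (square-nonneg (seq (re z) n)) (square-nonneg (seq (im z) n))

≤-+ʳ : ∀ p {q} → 0ℚ ℚ.≤ q → p ℚ.≤ p ℚ.+ q
≤-+ʳ p {q} 0≤q = ≡.subst (ℚ._≤ p ℚ.+ q) (ℚ.+-identityʳ p) (ℚ.+-monoʳ-≤ p 0≤q)

≤-+ˡ : ∀ p {q} → 0ℚ ℚ.≤ q → p ℚ.≤ q ℚ.+ p
≤-+ˡ p {q} 0≤q = ≡.subst (ℚ._≤ q ℚ.+ p) (ℚ.+-identityˡ p) (ℚ.+-monoˡ-≤ p 0≤q)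

-- The squares of the real and imaginary parts are both dominated termwise by `∣ z ∣²`.
∣z∣²≃0⇒z≈0 : ∣ z ∣² ≃ᴿ 0ᴿ → z ≈ 0#
∣z∣²≃0⇒z≈0 {z} e = mk≃ᶜ
  (square≃0 (≃0-dominated (λ n → square-nonneg (seq (re z) n))
    (λ n → ≤-+ʳ (seq (re z) n ℚ.* seq (re z) n) (square-nonneg (seq (im z) n))) e))
  (square≃0 (≃0-dominated (λ n → square-nonneg (seq (im z) n))
    (λ n → ≤-+ˡ (seq (im z) n ℚ.* seq (im z) n) (square-nonneg (seq (re z) n))) e))

z≈0⇒∣z∣²≃0 : z ≈ 0# → ∣ z ∣² ≃ᴿ 0ᴿ
z≈0⇒∣z∣²≃0 e = ℝR.trans (∣∣²-cong e) (≗⇒≃ λ _ → ≡.refl)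

≈0-stable : ¬ ¬ z ≈ 0# → z ≈ 0#
≈0-stable ¬¬e = mk≃ᶜ (≃0-stable λ ¬e → ¬¬e (¬e ∘ re≃)) (≃0-stable λ ¬e → ¬¬e (¬e ∘ im≃))

-- The squared modulus is multiplicative and detects zero, which reduces the claim to cancellation
-- in ℝ.
*ᶜ-cancelʳ-0 : z * w ≈ 0# → ¬ w ≈ 0# → z ≈ 0#
*ᶜ-cancelʳ-0 {z} {w} zw≈0 w≉0 = ∣z∣²≃0⇒z≈0 (*ᴿ-cancelʳ-0
  (ℝR.trans (ℝR.sym (∣∣²-* z w)) (z≈0⇒∣z∣²≃0 zw≈0))
  (w≉0 ∘ ∣z∣²≃0⇒z≈0))

1≉0 : ¬ 1# ≈ 0#
1≉0 e = away⇒≄0 1-away (re≃ e)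

-- Here and in `term≤sumᴿ`, the inequality concerns the `k`-th terms of the representing rational
-- sequences, the form that `≃0-dominated` and `away-dominating` take.
sumᴿ-nonneg : ∀ (v : Vector ℝ n) k → (∀ i → 0ℚ ℚ.≤ seq (v i) k) → 0ℚ ℚ.≤ seq (sumᴿ v) k
sumᴿ-nonneg {zero}  v k 0≤v = ℚ.≤-refl
sumᴿ-nonneg {suc n} v k 0≤v = ℚ.+-mono-≤ (0≤v zero) (sumᴿ-nonneg (v ∘ suc) k (0≤v ∘ suc))

term≤sumᴿ : ∀ (v : Vector ℝ n) k → (∀ i → 0ℚ ℚ.≤ seq (v i) k) → ∀ i → seq (v i) k ℚ.≤ seq (sumᴿ v) k
term≤sumᴿ {suc n} v k 0≤v zero    = ≤-+ʳ (seq (v zero) k) (sumᴿ-nonneg (v ∘ suc) k (0≤v ∘ suc))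
term≤sumᴿ {suc n} v k 0≤v (suc i) = ℚ.≤-trans (term≤sumᴿ (v ∘ suc) k (0≤v ∘ suc) i)
  (≤-+ˡ (seq (sumᴿ (v ∘ suc)) k) (0≤v zero))

fromℝ-sum : ∀ (v : Vector ℝ n) → fromℝ (sumᴿ v) ≈ sum (fromℝ ∘ v)
fromℝ-sum {zero}  v = refl
fromℝ-sum {suc n} v = trans (mk≃ᶜ ℝR.refl (≗⇒≃ λ _ → ≡.refl)) (+-congˡ {x = fromℝ (v zero)} (fromℝ-sum (v ∘ suc)))

-- Adjoint matrices and column norms.

ᴴ-involutive : ∀ (A : Matrix ℂ m n) → (A ᴴ) ᴴ ≋ A
ᴴ-involutive A i j = conj-involutive (A i j)

ᴴ-⊗ : ∀ {l} (A : Matrix ℂ l m) (B : Matrix ℂ m n) → (A ⊗ B) ᴴ ≋ B ᴴ ⊗ A ᴴ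
ᴴ-⊗ A B i k = trans (conj-sum λ j → A k j * B j i)
  (sum-cong-≋ λ j → trans (conj-* (A k j) (B j i)) (*-comm (conj (A k j)) (conj (B j i))))

columnNorm² : Matrix ℂ m n → Fin n → ℝ
columnNorm² A j = sumᴿ λ k → ∣ A k j ∣²

entry≤columnNorm² : ∀ (A : Matrix ℂ m n) i j k → seq ∣ A i j ∣² k ℚ.≤ seq (columnNorm² A j) k
entry≤columnNorm² A i j k = term≤sumᴿ (λ l → ∣ A l j ∣²) k (λ l → ∣∣²-nonneg (A l j) k) i

ᴴ⊗-diag : ∀ (A : Matrix ℂ m n) j → (A ᴴ ⊗ A) j j ≈ fromℝ (columnNorm² A j)
ᴴ⊗-diag A j = trans (sum-cong-≋ λ k → conj-*-self (A k j)) (sym (fromℝ-sum λ k → ∣ A k j ∣²))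

-- The diagonal of AᴴA consists of the squared column norms of A, and each of these dominates the
-- squared moduli of the entries in its column.
ᴴ⊗≋0⇒≋0 : ∀ (A : Matrix ℂ m n) → A ᴴ ⊗ A ≋ (λ _ _ → 0#) → A ≋ (λ _ _ → 0#)
ᴴ⊗≋0⇒≋0 A AᴴA≋0 k j = ∣z∣²≃0⇒z≈0 (≃0-dominated (∣∣²-nonneg (A k j)) (entry≤columnNorm² A k j)
  (re≃ (trans (sym (ᴴ⊗-diag A j)) (AᴴA≋0 j j))))

-- Multiplying by Bᴴ on the left turns the hypothesis into (AB)ᴴ(AB) = 0.
ᴴ⊗⊗≋0⇒⊗≋0 : ∀ {l} (A : Matrix ℂ l m) (B : Matrix ℂ m n) →
             A ᴴ ⊗ (A ⊗ B) ≋ (λ _ _ → 0#) → A ⊗ B ≋ (λ _ _ → 0#)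
ᴴ⊗⊗≋0⇒⊗≋0 {m} {n} {l} A B AᴴAB≋0 = ᴴ⊗≋0⇒≋0 (A ⊗ B) (begin
  (A ⊗ B) ᴴ ⊗ (A ⊗ B)      ≈⟨ ⊗-congʳ (A ⊗ B) (ᴴ-⊗ A B) ⟩
  (B ᴴ ⊗ A ᴴ) ⊗ (A ⊗ B)    ≈⟨ ⊗-assoc (B ᴴ) (A ᴴ) (A ⊗ B) ⟩
  B ᴴ ⊗ (A ᴴ ⊗ (A ⊗ B))    ≈⟨ ⊗-zeroʳ (B ᴴ) AᴴAB≋0 ⟩
  (λ _ _ → 0#) ∎)
  where open SetoidReasoning (≋-setoid n n)

-- Evaluating group rings at characters

open SemiringSolver commutativeSemiring using (solve; _:=_; _:+_; _:*_; con)

-- Sums and linear combinations in modules.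

module _ (M : ℂ-Module) where
  open RawLeftModule M
  open LinearAlgebra

  -- A sum in `M ^ᴹ n` folds whole vectors; this lets one coordinate be computed in `M`, and
  -- iterating it reaches matrix entries and coefficients.
  sumᴹ-lookup : ∀ (v : Vector (Vector Carrierᴹ n) m) i →
                sumᴹ (M ^ᴹ n) v i ≡ sumᴹ M (λ k → v k i)
  sumᴹ-lookup {m = zero}  v i = ≡.refl
  sumᴹ-lookup {m = suc m} v i = ≡.cong (v zero i +ᴹ_) (sumᴹ-lookup (v ∘ suc) i)

  linearCombination-closed : ∀ {p} {V : Pred Carrierᴹ p} → IsSubspace M V →
    ∀ (f : Vector Carrierᴹ n) → (∀ i → V (f i)) → ∀ c → V (linearCombination M c f)
  linearCombination-closed {zero}  V f f∈V c = IsSubspace.0-closed V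
  linearCombination-closed {suc n} V f f∈V c = IsSubspace.+-closed V
    (IsSubspace.*ₗ-closed V (c zero) (f∈V zero))
    (linearCombination-closed V (f ∘ suc) (f∈V ∘ suc) (c ∘ suc))

-- Evaluation as a ring homomorphism, and the square of a signature matrix.

module _ {c ℓ} (Γ : FiniteAbelianGroup c ℓ) where
  private
    module Γ = FiniteAbelianGroup Γ
    module GR = RawRing (groupRing Γ)
    module Mat = MatrixOperations (groupRing Γ)
    module Enum = Inverse Γ.enumeration
    open Γ using (element; index; _∙_; _⁻¹)
    open import Algebra.Properties.Group Γ.group using (\\-leftDividesˡ; \\-leftDividesʳ)

  -- The index change h ↦ g⁻¹h of the convolution product, with inverse h ↦ gh; it serves to reindex
  -- the sum in `extend-*`.
  translation : Fin Γ.order → Permutation′ Γ.order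
  translation i = permutation
    (λ k → index (element i ⁻¹ ∙ element k))
    (λ k → index (element i ∙ element k))
    (λ k → ≡.trans (Enum.from-cong (Γ.trans (Γ.∙-congˡ (Enum.strictlyInverseˡ _)) (\\-leftDividesʳ (element i) (element k))))
             (Enum.strictlyInverseʳ k))
    (λ k → ≡.trans (Enum.from-cong (Γ.trans (Γ.∙-congˡ (Enum.strictlyInverseˡ _)) (\\-leftDividesˡ (element i) (element k))))
             (Enum.strictlyInverseʳ k))

  module _ (α : Character Γ) where
    open Character α
    open IsMonoidHomomorphism isMonoidHomomorphism using (⟦⟧-cong; homo; ε-homo)

    private
      ext : GR.Carrier → ℂ
      ext = extend Γ α

    extend-cong : ∀ {x y} → x GR.≈ y → ext x ≈ ext y
    extend-cong x≈y = sum-cong-≋ λ k → *-congʳ (x≈y k)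

    extend-0 : ext GR.0# ≈ 0#
    extend-0 = sum-zero _ λ k → zeroˡ ⟦ element k ⟧

    extend-+ : ∀ x y → ext (x GR.+ y) ≈ ext x + ext y
    extend-+ x y = trans (sum-cong-≋ λ k → distribʳ ⟦ element k ⟧ (x k) (y k))
      (∑-distrib-+ (λ k → x k * ⟦ element k ⟧) (λ k → y k * ⟦ element k ⟧))

    extend-scale : ∀ c x → ext (λ k → c * x k) ≈ c * ext x
    extend-scale c x = trans (sum-cong-≋ λ k → *-assoc c (x k) ⟦ element k ⟧)
      (sym (*-distribˡ-sum c λ k → x k * ⟦ element k ⟧))

    extend-embed : ∀ g → ext (embed Γ g) ≈ ⟦ g ⟧
    extend-embed g = trans
      (sum-single _ (index g) λ k k≢g →
        trans (*-congʳ (reflexive (identity-off-diag k≢g))) (zeroˡ ⟦ element k ⟧))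
      (trans (*-congʳ (reflexive (identity-diag (index g))))
        (trans (*-identityˡ _) (⟦⟧-cong (Enum.strictlyInverseˡ g))))

    -- Splitting α(h) as α(g) α(g⁻¹h) and reindexing the sum over h by `translation` makes the
    -- double sum factor.
    extend-* : ∀ x y → ext (x GR.* y) ≈ ext x * ext y
    extend-* x y = begin
      ∑[ k < Γ.order ] (∑[ i < Γ.order ] (x i * y (π i k)) * ⟦ element k ⟧)
        ≈⟨ sum-cong-≋ (λ k → trans (*-distribʳ-sum ⟦ element k ⟧ (λ i → x i * y (π i k)))
             (sum-cong-≋ λ i → trans (*-congˡ (split i k))
               (solve 4 (λ x y a b → x :* y :* (a :* b) := x :* a :* (y :* b)) refl
                 (x i) (y (π i k)) ⟦ element i ⟧ ⟦ element (π i k) ⟧))) ⟩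
      ∑[ k < Γ.order ] ∑[ i < Γ.order ] (x i * ⟦ element i ⟧ * (y (π i k) * ⟦ element (π i k) ⟧))
        ≈⟨ ∑-comm (λ k i → x i * ⟦ element i ⟧ * (y (π i k) * ⟦ element (π i k) ⟧)) ⟩
      ∑[ i < Γ.order ] ∑[ k < Γ.order ] (x i * ⟦ element i ⟧ * (y (π i k) * ⟦ element (π i k) ⟧))
        ≈⟨ sum-cong-≋ (λ i → trans
             (sym (*-distribˡ-sum (x i * ⟦ element i ⟧) (λ k → y (π i k) * ⟦ element (π i k) ⟧)))
             (*-congˡ (sym (sum-permute (λ k → y k * ⟦ element k ⟧) (translation i))))) ⟩
      ∑[ i < Γ.order ] (x i * ⟦ element i ⟧ * ext y)
        ≈⟨ *-distribʳ-sum (ext y) (λ i → x i * ⟦ element i ⟧) ⟨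
      ext x * ext y ∎
      where
      open SetoidReasoning setoid

      π : Fin Γ.order → Fin Γ.order → Fin Γ.order
      π i k = index (element i ⁻¹ ∙ element k)

      split : ∀ i k → ⟦ element k ⟧ ≈ ⟦ element i ⟧ * ⟦ element (π i k) ⟧
      split i k = trans (⟦⟧-cong (Γ.sym (Γ.trans (Γ.∙-congˡ (Enum.strictlyInverseˡ _))
          (\\-leftDividesˡ (element i) (element k)))))
        (homo (element i) (element (π i k)))

    extend-sum : ∀ (v : Vector GR.Carrier n) → ext (rawSum GR.+-rawMonoid v) ≈ sum (ext ∘ v)
    extend-sum {zero}  v = extend-0
    extend-sum {suc n} v = trans (extend-+ (v zero) _) (+-congˡ (extend-sum (v ∘ suc)))

    evaluate-⊗ : ∀ (A B : Matrix GR.Carrier n n) →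
                 evaluate Γ α (A Mat.⊗ B) ≋ evaluate Γ α A ⊗ evaluate Γ α B
    evaluate-⊗ A B i k = trans (extend-sum λ j → A i j GR.* B j k)
      (sum-cong-≋ λ j → extend-* (A i j) (B j k))

    evaluate-· : ∀ g (A : Matrix GR.Carrier n n) →
                 evaluate Γ α (embed Γ g Mat.· A) ≋ ⟦ g ⟧ · evaluate Γ α A
    evaluate-· g A i j = trans (extend-* (embed Γ g) (A i j)) (*-congʳ (extend-embed g))

    evaluate-identity : evaluate Γ α (Mat.identity n) ≋ identity n
    evaluate-identity i j with i Fin.≟ j
    ... | yes _ = trans (extend-embed Γ.ε) ε-homo
    ... | no _  = extend-0

    -- Evaluation sends each gI to α(g) I and each gB to α(g) S. Hence it sends the whole roux
    -- algebra, and in particular the square of a generator that evaluates to S, into the span of I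
    -- and S.
    roux-square : ∀ {B : Matrix GR.Carrier n n} → IsRoux Γ B →
      let S = evaluate Γ α B in ∃ λ a → ∃ λ b → S ⊗ S ≋ a · identity n ⊕ b · S
    roux-square {n} {B} roux =
      let (c , BB≈)    = ⊗-closed gB∈span gB∈span
          (a , b , eq) = linearCombination-closed matrices affine-subspace generators generators-affine c
      in a , b , (begin
        S ⊗ S                                       ≈⟨ ⊗-cong evaluate-gB evaluate-gB ⟨
        evaluate Γ α gB ⊗ evaluate Γ α gB           ≈⟨ evaluate-⊗ gB gB ⟨
        evaluate Γ α (gB Mat.⊗ gB)                  ≈⟨ (λ i j → extend-cong (BB≈ i j)) ⟩
        evaluate Γ α (LinearAlgebra.linearCombination matrices c generators) ≈⟨ eq ⟩
        a · identity n ⊕ b · S                      ∎)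
      where
      open SetoidReasoning (≋-setoid n n)
      open IsRoux roux using (algebra)
      open IsAlgebra algebra using (⊗-closed)

      matrices : ℂ-Module
      matrices = groupModule Γ ^ᴹ n ^ᴹ n

      S : Matrix ℂ n n
      S = evaluate Γ α B

      multiplesOf : Matrix GR.Carrier n n → Vector (Matrix GR.Carrier n n) Γ.order
      multiplesOf X k = embed Γ (element k) Mat.· X

      generators : Vector (Matrix GR.Carrier n n) (Γ.order ℕ.+ Γ.order)
      generators = multiplesOf (Mat.identity n) ++ multiplesOf B

      -- The preimage of the span of I and S under evaluation. It is a subspace that contains the
      -- generators, hence also all their linear combinations.
      AffineInS : Pred (Matrix GR.Carrier n n) 0ℓ
      AffineInS X = ∃ λ a → ∃ λ b → evaluate Γ α X ≋ a · identity n ⊕ b · S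

      affine-subspace : LinearAlgebra.IsSubspace matrices AffineInS
      affine-subspace = record
        { resp = λ X≈Y (a , b , eq) → a , b , λ i j → trans (sym (extend-cong (X≈Y i j))) (eq i j)
        ; 0-closed = 0# , 0# , λ i j → trans extend-0
            (solve 2 (λ e s → con 0 := con 0 :* e :+ con 0 :* s) refl (identity n i j) (S i j))
        ; +-closed = λ {X} {Y} (a , b , eq) (a′ , b′ , eq′) → a + a′ , b + b′ , λ i j →
            trans (extend-+ (X i j) (Y i j)) (trans (+-cong (eq i j) (eq′ i j))
              (solve 6 (λ a b a′ b′ e s → (a :* e :+ b :* s) :+ (a′ :* e :+ b′ :* s)
                  := (a :+ a′) :* e :+ (b :+ b′) :* s)
                refl a b a′ b′ (identity n i j) (S i j)))
        ; *ₗ-closed = λ c {X} (a , b , eq) → c * a , c * b , λ i j →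
            trans (extend-scale c (X i j)) (trans (*-congˡ (eq i j))
              (solve 5 (λ c a b e s → c :* (a :* e :+ b :* s) := c :* a :* e :+ c :* b :* s)
                refl c a b (identity n i j) (S i j)))
        }

      generators-affine : ∀ k → AffineInS (generators k)
      generators-affine = All.++⁺ AffineInS {xs = multiplesOf (Mat.identity n)} {ys = multiplesOf B}
        (λ k → ⟦ element k ⟧ , 0# , λ i j →
          trans (evaluate-· (element k) (Mat.identity n) i j) (trans (*-congˡ (evaluate-identity i j))
            (solve 3 (λ a e s → a :* e := a :* e :+ con 0 :* s) refl ⟦ element k ⟧ (identity n i j) (S i j))))
        (λ k → 0# , ⟦ element k ⟧ , λ i j →
          trans (evaluate-· (element k) B i j)
            (solve 3 (λ b e s → b :* s := con 0 :* e :+ b :* s) refl ⟦ element k ⟧ (identity n i j) (S i j)))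

      -- The position of εB in the second half of the generators. This matrix stands in for B: it is
      -- itself a generator, and it evaluates to α(ε) S = S.
      k₀ : Fin (Γ.order ℕ.+ Γ.order)
      k₀ = Γ.order ↑ʳ index Γ.ε

      gB : Matrix GR.Carrier n n
      gB = generators k₀

      gB∈span : LinearAlgebra.Span matrices generators gB
      -- The coefficients are a row of the identity matrix, so `⊗-identityˡ` picks out the
      -- generator.
      gB∈span = identity _ k₀ , λ i j x → trans
        (sym (⊗-identityˡ (column λ l → generators l i j x) k₀ zero))
        (reflexive (≡.sym (lookup₃ (λ l i j x → identity _ k₀ l * generators l i j x) i j x)))
        where
        lookup₃ : ∀ {N} (v : Vector (Matrix GR.Carrier n n) N) i j x →
                  LinearAlgebra.sumᴹ matrices v i j x ≡ sum (λ l → v l i j x)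
        lookup₃ v i j x = ≡.trans
          (≡.cong (λ w → w j x) (sumᴹ-lookup (groupModule Γ ^ᴹ n) v i))
          (≡.trans (≡.cong (λ w → w x) (sumᴹ-lookup (groupModule Γ) (λ l → v l i) j))
            (sumᴹ-lookup ℂ¹ (λ l → v l i j) x))

      evaluate-gB : evaluate Γ α gB ≋ S
      evaluate-gB i j = trans
        (reflexive (≡.cong (λ X → evaluate Γ α X i j) (lookup-++ʳ (multiplesOf (Mat.identity n)) (multiplesOf B) (index Γ.ε))))
        (trans (evaluate-· (element (index Γ.ε)) B i j)
          (trans (*-congʳ (trans (⟦⟧-cong (Enum.strictlyInverseˡ Γ.ε)) ε-homo)) (*-identityˡ (S i j))))

-- Frames

x≈y⇒x-y≈0 : ∀ {x y} → x ≈ y → x - y ≈ 0#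
x≈y⇒x-y≈0 {y = y} x≈y = trans (+-congʳ x≈y) (-‿inverseʳ y)

-- Synthesis matrices, Gram matrices and linear dependence.

synthesis : Vector (ℂVec D) n → Matrix ℂ D n
synthesis φ k i = φ i k

gram≋ᴴ⊗ : ∀ (φ : Vector (ℂVec D) n) → gram φ ≋ synthesis φ ᴴ ⊗ synthesis φ
gram≋ᴴ⊗ φ i j = sum-cong-≋ λ k → *-comm (φ j k) (conj (φ i k))

ᴴ⊗-selfAdjoint : ∀ (Φ : Matrix ℂ m n) → (Φ ᴴ ⊗ Φ) ᴴ ≋ Φ ᴴ ⊗ Φ
ᴴ⊗-selfAdjoint Φ = ≋-trans (ᴴ-⊗ (Φ ᴴ) Φ) (⊗-congˡ (Φ ᴴ) (ᴴ-involutive Φ))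

linearCombination≈ : ∀ (c : Vector ℂ n) (φ : Vector (ℂVec D) n) k →
  LinearAlgebra.linearCombination (ℂ^ D) c φ k ≈ (synthesis φ ⊗ column c) k zero
linearCombination≈ c φ k = trans (reflexive (sumᴹ-lookup ℂ¹ (λ i l → c i * φ i l) k))
  (sum-cong-≋ λ i → *-comm (c i) (φ i k))

-- The summands are φᵢ at position `i` and zero elsewhere, obtained by scaling with a row of the
-- identity matrix.
member⇒∈SpanOf : ∀ {p} (V : Fin n → Pred (ℂVec D) p) →
  (∀ i → LinearAlgebra.IsSubspace (ℂ^ D) (V i)) →
  ∀ {φ : Vector (ℂVec D) n} → (∀ i → V i (φ i)) → ∀ i → LinearAlgebra.SpanOf (ℂ^ D) V (φ i)
member⇒∈SpanOf {n} V subspace {φ} φ∈V i =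
  (λ j k → identity n i j * φ j k) ,
  (λ j → LinearAlgebra.IsSubspace.*ₗ-closed (subspace j) (identity n i j) (φ∈V j)) ,
  λ k → trans (sym (⊗-identityˡ φ i k))
    (reflexive (≡.sym (sumᴹ-lookup ℂ¹ (λ j l → identity n i j * φ j l) k)))

-- The coordinates of the φᵢ with respect to `e` form a d × n matrix `A` with Φ = E A for E =
-- `synthesis e`. As d < n, `A` has a nonzero kernel vector, and Φ kills it too.
¬¬-dependency : ∀ (e : Vector (ℂVec D) d) (φ : Vector (ℂVec D) n) → d ℕ.< n →
  (∀ i → LinearAlgebra.Span (ℂ^ D) e (φ i)) →
  ¬ ¬ ∃ λ (v : Vector ℂ n) →
    (∃ λ (i : Fin n) → ¬ v i ≈ 0#) × synthesis φ ⊗ column v ≋ (λ _ _ → 0#)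
¬¬-dependency {D} {d} {n} e φ d<n φ∈span ¬dep =
  ¬¬-kernel 1≉0 ≈0-stable *ᶜ-cancelʳ-0 A d<n λ (v , v≉0 , Av≈0) →
    ¬dep (v , v≉0 , (begin
      synthesis φ ⊗ column v         ≈⟨ ⊗-congʳ (column v) factorization ⟩
      (synthesis e ⊗ A) ⊗ column v   ≈⟨ ⊗-assoc (synthesis e) A (column v) ⟩
      synthesis e ⊗ (A ⊗ column v)   ≈⟨ ⊗-zeroʳ (synthesis e) (λ k _ → Av≈0 k) ⟩
      (λ _ _ → 0#) ∎))
  where
  open SetoidReasoning (≋-setoid D 1)

  A : Matrix ℂ d n
  A l i = proj₁ (φ∈span i) l

  factorization : synthesis φ ≋ synthesis e ⊗ A
  factorization k i = trans (proj₂ (φ∈span i) k) (linearCombination≈ (λ l → A l i) e k)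

-- Applied to v, the relation loses its terms in G and becomes p v = t v; the nonzero entry of v
-- then cancels.
kernel⇒coefficients≈ : ∀ {G : Matrix ℂ n n} {p t} → G ⊗ G ⊕ p · identity n ≋ p · G ⊕ t · identity n →
  ∀ (v : Vector ℂ n) i → ¬ v i ≈ 0# → G ⊗ column v ≋ (λ _ _ → 0#) → p ≈ t
kernel⇒coefficients≈ {n} {G} {p} {t} G² v i v≉0 Gv≋0 = x-y≈0⇒x≈y p t (*ᶜ-cancelʳ-0
  (trans ([y-z]x≈yx-zx (v i) p t) (x≈y⇒x-y≈0 (pv≋tv i zero))) v≉0)
  where
  open SetoidReasoning (≋-setoid n 1)

  ·I : ∀ x → (x · identity n) ⊗ column v ≋ x · column v
  ·I x i j = trans (·-⊗ x (identity n) (column v) i j) (·-cong refl (⊗-identityˡ (column v)) i j)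

  pv≋tv : p · column v ≋ t · column v
  pv≋tv = begin
    p · column v                                         ≈⟨ (λ i j → sym (+-identityˡ _)) ⟩
    (λ _ _ → 0#) ⊕ p · column v                          ≈⟨ ⊕-cong (≋-trans (⊗-assoc G G (column v)) (⊗-zeroʳ G Gv≋0)) (·I p) ⟨
    (G ⊗ G) ⊗ column v ⊕ (p · identity n) ⊗ column v     ≈⟨ ⊗-distribʳ-⊕ (G ⊗ G) (p · identity n) (column v) ⟨
    (G ⊗ G ⊕ p · identity n) ⊗ column v                  ≈⟨ ⊗-congʳ (column v) G² ⟩
    (p · G ⊕ t · identity n) ⊗ column v                  ≈⟨ ⊗-distribʳ-⊕ (p · G) (t · identity n) (column v) ⟩
    (p · G) ⊗ column v ⊕ (t · identity n) ⊗ column v     ≈⟨ ⊕-cong (λ i j → trans (·-⊗ p G (column v) i j) (trans (*-congˡ (Gv≋0 i j)) (zeroʳ p))) (·I t) ⟩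
    (λ _ _ → 0#) ⊕ t · column v                          ≈⟨ (λ i j → +-identityˡ _) ⟩
    t · column v ∎

-- Here p = p Gᵢᵢ = (G²)ᵢᵢ = (GᴴG)ᵢᵢ is the squared norm of column i. It dominates ∣Gᵢᵢ∣² = 1, so it
-- is away from zero.
coefficient-invertible : ∀ {G : Matrix ℂ n n} {p} → G ᴴ ≋ G → G ⊗ G ≋ p · G →
  ∀ i → G i i ≈ 1# → ∃ λ r → p ≈ fromℝ r × ∃ λ s → r *ᴿ s ≃ᴿ 1ᴿ
coefficient-invertible {n} {G} {p} selfAdjoint G² i Gᵢᵢ≈1 =
  columnNorm² G i , p≈r , away⇒invertible (away-dominating {x = ∣ G i i ∣²} {y = columnNorm² G i}
    (∣∣²-nonneg (G i i)) (entry≤columnNorm² G i i)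
    (away-resp-≃ {x = 1ᴿ} {y = ∣ G i i ∣²} 1-away (ℝR.sym (ℝR.trans (∣∣²-cong Gᵢᵢ≈1) ∣1∣²≃1))))
  where
  open SetoidReasoning setoid

  p≈r : p ≈ fromℝ (columnNorm² G i)
  p≈r = begin
    p                         ≈⟨ *-identityʳ p ⟨
    p * 1#                    ≈⟨ *-congˡ Gᵢᵢ≈1 ⟨
    p * G i i                 ≈⟨ G² i i ⟨
    (G ⊗ G) i i               ≈⟨ ⊗-congʳ G selfAdjoint i i ⟨
    (G ᴴ ⊗ G) i i             ≈⟨ ᴴ⊗-diag G i ⟩
    fromℝ (columnNorm² G i)   ∎

-- For Y = G - p I the hypothesis reads Φᴴ(ΦY) = 0, and `ᴴ⊗⊗≋0⇒⊗≋0` removes the factor Φᴴ.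
⊗-gram : ∀ (Φ : Matrix ℂ m n) {p} → (Φ ᴴ ⊗ Φ) ⊗ (Φ ᴴ ⊗ Φ) ≋ p · (Φ ᴴ ⊗ Φ) → Φ ⊗ (Φ ᴴ ⊗ Φ) ≋ p · Φ
⊗-gram {m} {n} Φ {p} G² i j = x-y≈0⇒x≈y _ _ (begin
  (Φ ⊗ G) i j - p * Φ i j          ≈⟨ shift Φ i j ⟨
  (Φ ⊗ (G ⊕ - p · identity n)) i j ≈⟨ ᴴ⊗⊗≋0⇒⊗≋0 Φ Y ΦᴴΦY≋0 i j ⟩
  0# ∎)
  where
  open SetoidReasoning setoid

  G Y : Matrix ℂ n n
  G = Φ ᴴ ⊗ Φ
  Y = G ⊕ - p · identity n

  -- Used with `A` = Φ for the conclusion and with `A` = G for the hypothesis.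
  shift : ∀ {l} (A : Matrix ℂ l n) i j → (A ⊗ Y) i j ≈ (A ⊗ G) i j - p * A i j
  shift A i j = begin
    (A ⊗ Y) i j                              ≈⟨ ⊗-distribˡ-⊕ A G (- p · identity n) i j ⟩
    (A ⊗ G) i j + (A ⊗ (- p · identity n)) i j ≈⟨ +-congˡ (⊗-· (- p) A (identity n) i j) ⟩
    (A ⊗ G) i j + - p * (A ⊗ identity n) i j ≈⟨ +-congˡ (*-congˡ (⊗-identityʳ A i j)) ⟩
    (A ⊗ G) i j + - p * A i j                ≈⟨ +-congˡ (-‿distribˡ-* p (A i j)) ⟨
    (A ⊗ G) i j - p * A i j ∎

  ΦᴴΦY≋0 : Φ ᴴ ⊗ (Φ ⊗ Y) ≋ (λ _ _ → 0#)
  ΦᴴΦY≋0 i j = begin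
    (Φ ᴴ ⊗ (Φ ⊗ Y)) i j      ≈⟨ ⊗-assoc (Φ ᴴ) Φ Y i j ⟨
    (G ⊗ Y) i j              ≈⟨ shift G i j ⟩
    (G ⊗ G) i j - p * G i j  ≈⟨ x≈y⇒x-y≈0 (G² i j) ⟩
    0# ∎

-- The frame operator and the projection onto the span.

frameOperator≋ : ∀ (φ : Vector (ℂVec D) n) → frameOperator φ ≋ synthesis φ ⊗ synthesis φ ᴴ
frameOperator≋ {D} φ k l = reflexive (≡.trans
  (≡.cong (λ w → w l) (sumᴹ-lookup (ℂ^ D) (λ i k l → φ i k * conj (φ i l)) k))
  (sumᴹ-lookup ℂ¹ (λ i l → φ i k * conj (φ i l)) l))

-- The factorization P = ΦΨ puts the range of P into the span, and PΦ = Φ, which follows from s p =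
-- 1, makes P fix the span. Together they give idempotence; P is self-adjoint because s is real.
gram-projection : ∀ (φ : Vector (ℂVec D) n) s {p} → fromℝ s * p ≈ 1# →
  let Φ = synthesis φ in Φ ⊗ (Φ ᴴ ⊗ Φ) ≋ p · Φ →
  IsOrthogonalProjectionOnto (fromℝ s · (Φ ⊗ Φ ᴴ)) (LinearAlgebra.Span (ℂ^ D) φ)
gram-projection {D} {n} φ s {p} sp≈1 ΦG = record
  { idempotent  = λ i k → begin
      (P ⊗ P) i k            ≈⟨ ⊗-congˡ P P≋ΦΨ i k ⟩
      (P ⊗ (Φ ⊗ Ψ)) i k      ≈⟨ ⊗-assoc P Φ Ψ i k ⟨
      ((P ⊗ Φ) ⊗ Ψ) i k      ≈⟨ ⊗-congʳ Ψ PΦ≋Φ i k ⟩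
      (Φ ⊗ Ψ) i k            ≈⟨ P≋ΦΨ i k ⟨
      P i k ∎
  ; selfAdjoint = λ i j → trans (conj-* (fromℝ s) ((Φ ⊗ Φ ᴴ) j i)) (*-cong (conj-fromℝ s)
      (trans (ᴴ-⊗ Φ (Φ ᴴ) i j) (⊗-congʳ (Φ ᴴ) (ᴴ-involutive Φ) i j)))
  ; range       = λ v → mk⇔ (fixed v) (inSpan v)
  }
  where
  open SetoidReasoning setoid

  Φ : Matrix ℂ D n
  Φ = synthesis φ

  Ψ : Matrix ℂ n D
  Ψ = fromℝ s · Φ ᴴ

  P : Matrix ℂ D D
  P = fromℝ s · (Φ ⊗ Φ ᴴ)

  P≋ΦΨ : P ≋ Φ ⊗ Ψ
  P≋ΦΨ = ≋-sym (⊗-· (fromℝ s) Φ (Φ ᴴ))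

  PΦ≋Φ : P ⊗ Φ ≋ Φ
  PΦ≋Φ i j = begin
    (P ⊗ Φ) i j                        ≈⟨ ·-⊗ (fromℝ s) (Φ ⊗ Φ ᴴ) Φ i j ⟩
    fromℝ s * ((Φ ⊗ Φ ᴴ) ⊗ Φ) i j      ≈⟨ *-congˡ (⊗-assoc Φ (Φ ᴴ) Φ i j) ⟩
    fromℝ s * (Φ ⊗ (Φ ᴴ ⊗ Φ)) i j      ≈⟨ *-congˡ (ΦG i j) ⟩
    fromℝ s * (p * Φ i j)              ≈⟨ *-assoc (fromℝ s) p (Φ i j) ⟨
    fromℝ s * p * Φ i j                ≈⟨ *-congʳ sp≈1 ⟩
    1# * Φ i j                         ≈⟨ *-identityˡ (Φ i j) ⟩
    Φ i j ∎

  fixed : ∀ v → LinearAlgebra.Span (ℂ^ D) φ v → ∃ λ u → ∀ k → v k ≈ apply P u k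
  -- A vector in the span is fixed by P, so it is its own preimage.
  fixed v (c , v≈) = v , λ k → sym (begin
    (P ⊗ column v) k zero              ≈⟨ ⊗-congˡ P v≋Φc k zero ⟩
    (P ⊗ (Φ ⊗ column c)) k zero        ≈⟨ ⊗-assoc P Φ (column c) k zero ⟨
    ((P ⊗ Φ) ⊗ column c) k zero        ≈⟨ ⊗-congʳ (column c) PΦ≋Φ k zero ⟩
    (Φ ⊗ column c) k zero              ≈⟨ v≋Φc k zero ⟨
    v k ∎)
    where
    v≋Φc : column v ≋ Φ ⊗ column c
    v≋Φc k zero = trans (v≈ k) (linearCombination≈ c φ k)

  inSpan : ∀ v → (∃ λ u → ∀ k → v k ≈ apply P u k) → LinearAlgebra.Span (ℂ^ D) φ v
  inSpan v (u , v≈) = (λ i → (Ψ ⊗ column u) i zero) , λ k → begin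
    v k                                ≈⟨ v≈ k ⟩
    (P ⊗ column u) k zero              ≈⟨ ⊗-congʳ (column u) P≋ΦΨ k zero ⟩
    ((Φ ⊗ Ψ) ⊗ column u) k zero        ≈⟨ ⊗-assoc Φ Ψ (column u) k zero ⟩
    (Φ ⊗ (Ψ ⊗ column u)) k zero        ≈⟨ linearCombination≈ (λ i → (Ψ ⊗ column u) i zero) φ k ⟨
    LinearAlgebra.linearCombination (ℂ^ D) (λ i → (Ψ ⊗ column u) i zero) φ k ∎

-- Equiangularity, and the relation G² = p G for roux lines.

equiangular-gram : ∀ (φ : Vector (ℂVec D) n) {S : Matrix ℂ n n} μ →
  (∀ {i j} → i ≢ j → UnitModulus (S i j)) → gram φ ≋ identity n ⊕ fromℝ μ · S →
  ∀ {i j} → i ≢ j → ∣ ⟨ φ i , φ j ⟩ ∣² ≃ᴿ ∣ fromℝ μ ∣²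
equiangular-gram φ {S} μ unimodular gram≋ {i} {j} i≢j = ℝR.trans
  -- The inner product of φᵢ with φⱼ is the (j, i) entry of the Gram matrix, whence the swapped
  -- indices.
  (∣∣²-cong (trans (gram≋ j i) (trans (+-congʳ (reflexive (identity-off-diag (i≢j ∘ ≡.sym)))) (+-identityˡ _))))
  (ℝR.trans (∣∣²-* (fromℝ μ) (S j i))
    (ℝR.trans (ℝR.*-congˡ (unimodular (i≢j ∘ ≡.sym))) (ℝR.*-identityʳ _)))

gram-square : ∀ {c ℓ p} {L : Fin n → Line D p} (rl : IsRouxLines c ℓ L) →
  let Φ = synthesis (IsRouxLines.representatives rl) ; G = Φ ᴴ ⊗ Φ
  in ∃ λ p → G ⊗ G ≋ p · G
gram-square {n} {D} {L = L} rl =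
  -- Once `t` is replaced by `p`, the multiple of the identity cancels from `quadratic-G`.
  p , λ i j → +-cancelʳ _ _ _ (trans (quadratic-G i j) (+-congˡ (*-congʳ (sym p≈t))))
  where
  open IsRouxLines rl renaming (representatives to φ)
  open HasSignatureMatrix hasSignature

  S G : Matrix ℂ n n
  S = evaluate Γ α roux
  G = synthesis φ ᴴ ⊗ synthesis φ

  a b p t : ℂ
  a = proj₁ (roux-square Γ α isRoux)
  b = proj₁ (proj₂ (roux-square Γ α isRoux))
  p = 1# + 1# + fromℝ μ * b
  t = 1# + fromℝ μ * (fromℝ μ * a)

  G≋ : G ≋ identity n ⊕ fromℝ μ · S
  G≋ i j = trans (sym (gram≋ᴴ⊗ φ i j)) (gram≋ i j)

  quadratic-G : G ⊗ G ⊕ p · identity n ≋ p · G ⊕ t · identity n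
  quadratic-G i j = trans (+-congʳ (⊗-cong G≋ G≋ i j))
    (trans (quadratic (fromℝ μ) (proj₂ (proj₂ (roux-square Γ α isRoux))) i j)
      (+-congʳ (*-congˡ (sym (G≋ i j)))))

  p≈t : p ≈ t
  p≈t = let (d , d<n , dimension) = linearlyDependent in
    let open LinearAlgebra.HasDimension dimension in
    -- Stability turns the goal into a contradiction, so the kernel vector, known only up to double
    -- negation, may be used.
    x-y≈0⇒x≈y p t (≈0-stable λ p-t≉0 →
      ¬¬-dependency basis φ d<n
        (λ i → spanning (member⇒∈SpanOf (λ i → L i ∋_) (λ i → Line.isSubspace (L i)) (proj₂ represents) i))
        λ (v , (i , vᵢ≉0) , Φv≋0) → p-t≉0 (x≈y⇒x-y≈0 (kernel⇒coefficients≈ quadratic-G v i vᵢ≉0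
          (≋-trans (⊗-assoc (synthesis φ ᴴ) (synthesis φ) (column v)) (⊗-zeroʳ (synthesis φ ᴴ) Φv≋0)))))

corollary1p5 : ∀ {c ℓ p : Level} {D n : ℕ} (L : Fin n → Line D p) →
    IsRouxLines c ℓ L →
    ∃ λ φ → Represents φ L × IsEquiangularTightFrameForSpan φ
-- An empty sequence is never linearly dependent, since its dimension would have to be below 0.
corollary1p5 {n = zero} L rl with IsRouxLines.linearlyDependent rl
... | _ , () , _
corollary1p5 {D = D} {n = suc n} L rl = φ , represents , record
  { unitNorm    = proj₁ represents
  ; equiangular = λ i≢j k≢l → ℝR.trans (angle i≢j) (ℝR.sym (angle k≢l))
  ; tight       =
      let (p , G²) = gram-square rl
          -- Any diagonal entry would serve; index `zero` exists because the sequence is nonempty.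
          (r , p≈r , s , rs≃1) = coefficient-invertible (ᴴ⊗-selfAdjoint Φ) G² zero
            (trans (sym (gram≋ᴴ⊗ φ zero zero)) (proj₁ represents zero))
          sr≈1 = trans (fromℝ-* s r) (fromℝ-cong (ℝR.trans (ℝR.*-comm s r) rs≃1))
      -- The frame operator ΦΦᴴ is r times the projection s ΦΦᴴ, where r is the real value of p and
      -- s is its inverse.
      in fromℝ r , fromℝ s · (Φ ⊗ Φ ᴴ) ,
         gram-projection φ s (trans (*-congˡ p≈r) sr≈1) (⊗-gram Φ G²) ,
         λ k l → trans (frameOperator≋ φ k l) (sym (trans (sym (*-assoc (fromℝ r) (fromℝ s) _))
           (trans (*-congʳ (trans (*-comm (fromℝ r) (fromℝ s)) sr≈1)) (*-identityˡ _))))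
  }
  where
  open IsRouxLines rl renaming (representatives to φ)
  open HasSignatureMatrix hasSignature

  Φ : Matrix ℂ D (suc n)
  Φ = synthesis φ

  angle : ∀ {i j} → i ≢ j → ∣ ⟨ φ i , φ j ⟩ ∣² ≃ᴿ ∣ fromℝ μ ∣²
  angle = equiangular-gram φ μ (IsSignatureMatrix.unitModulus isSignatureMatrix) gram≋
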